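{- Let $q$ be a power of $2$, and let $f(X)=X^4\bigl(1+aX^{q-1}+bX^{3(q-1)}\bigr)\in\mathbb{F}_{q^2}[X]$, where $a\in\mathbb{F}_q^*$ and $b\in\mathbb{F}_{q^2}^*$. Then $f$ is a permutation polynomial of $\mathbb{F}_{q^2}$ if and only if $a=b$ and the polynomial $X^3+X+a^{ -1}$ has no root in $\mathbb{F}_q$.
   Context: $\mathbb{F}_q$ denotes the finite field with $q$ elements and $\mathbb{F}_q^*$ its multiplicative group of nonzero elements. A polynomial $f\in\mathbb{F}_{q^2}[X]$ is a permutation polynomial of $\mathbb{F}_{q^2}$ if the map $x\mapsto f(x)$ is a bijection of $\mathbb{F}_{q^2}$ onto itself. -}

module Defs where

open import Level using (Level; suc; _⊔_)
open import Data.Nat using (ℕ; _∸_) renaming (_*_ to _*ℕ_; _^_ to _^ℕ_)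
open import Data.Fin using (Fin)
open import Data.Product using (∃; _×_)
open import Relation.Nullary using (¬_)
open import Relation.Binary.Definitions using (Decidable)
open import Relation.Binary.PropositionalEquality using (_≡_)
open import Algebra.Bundles using (CommutativeRing; Semiring)
import Algebra.Definitions.RawSemiring as RawSemiringDefs

record Field (c ℓ : Level) : Set (suc (c ⊔ ℓ)) where
  field
    commutativeRing : CommutativeRing c ℓ
  open CommutativeRing commutativeRing public
  field
    _≟_     : Decidable _≈_
    0≉1     : ¬ (0# ≈ 1#)
    _⁻¹     : (x : Carrier) → ¬ (x ≈ 0#) → Carrier
    ⁻¹-inverse : (x : Carrier) (nz : ¬ (x ≈ 0#)) → x * (x ⁻¹) nz ≈ 1#
  open RawSemiringDefs (Semiring.rawSemiring semiring) public using (_^_)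

record HasCardinality {c ℓ} (F : Field c ℓ) (n : ℕ) : Set (c ⊔ ℓ) where
  open Field F
  field
    enum       : Fin n → Carrier
    enum-inj   : ∀ i j → enum i ≈ enum j → i ≡ j
    enum-surj  : ∀ x → ∃ λ i → enum i ≈ x

module _ {c ℓ} (F : Field c ℓ) where
  open Field F

  IsPermutation : (Carrier → Carrier) → Set (c ⊔ ℓ)
  IsPermutation g = (∀ x y → g x ≈ g y → x ≈ y) × (∀ y → ∃ λ x → g x ≈ y)

  -- membership in the subfield F_q of F_{q^2}: the fixed points of x ↦ x^q
  InSubfield : ℕ → Carrier → Set ℓ
  InSubfield q x = x ^ q ≈ x

  fPoly : ℕ → Carrier → Carrier → Carrier → Carrier
  fPoly q a b x = (x ^ 4) * ((1# + a * (x ^ (q ∸ 1))) + b * (x ^ (3 *ℕ (q ∸ 1))))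

{-# OPTIONS --safe #-}
-- Write x̄ = x^q, so that f(x) = x⁴ + a x³x̄ + b x x̄³.
--
-- If a = b, then f(x) + f(x)‾ = (x + x̄)⁴, so f(x) determines c = x + x̄, and on the coset x̄ = x + c
-- the form f is the additive polynomial x⁴ + ac²x² + ac³x. A nonzero e in its kernel with ē = e is the
-- same thing as the root c/e + 1 of X³ + X + a⁻¹.
--
-- That a = b is necessary follows from Hermite's criterion. Put D = 1 + av + bv³ and
-- N = v⁴ + av³ + b̄v, so that f(x)^(q-1) = N/D at v = x^(q-1). If f is a permutation, then for all
-- αᵢ, βᵢ the sum of v⁴ ∏ᵢ (αᵢD + βᵢN)^(2ⁱ), i < k, over the roots of unity v of order q + 1 vanishes.
-- Reading the exponents in base 2 with carries in {1,2,3}, this sum is the trace of a product of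
-- 3 × 3 matrices, one for each digit. With K = a² + b b̄, the letter aD + bN has rank one if K = 0, and
-- suitable words give products of powers of a, b and a + b. If K ≠ 0, the pencil contains the sparse letters
-- A = p + v + sv⁴ and B = r + v³ + pv⁴ with (p, r, s) = (a, b̄, b)/K, and the words consisting of a
-- long run of A followed by at most three further letters lead to a contradiction (for q = 4 with f(1) ≠ 0).
module Submission where

open import Defs
open import Data.Bool using (Bool; true; false; _xor_; _∧_)
open import Data.Empty using (⊥; ⊥-elim)
open import Data.Fin using (Fin; zero; suc; punchIn; punchOut; inject≤)
open import Data.Fin.Permutation using (Permutation′; permutation)
open import Data.Fin.Properties using (any?; punchInᵢ≢i; punchIn-injective; punchOut-injective; inject≤-injective; injective⇒≤; suc-injective)
open import Data.Maybe using (just; nothing)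
open import Data.Nat using (ℕ; zero; suc; _∸_; _≤_; _<_; z≤n; s≤s; >-nonZero; _%_; _/_) renaming (_+_ to _+ℕ_; _^_ to _^ℕ_; _*_ to _*ℕ_)
open import Data.Nat.DivMod using (m≡m%n+[m/n]*n; m%n<n; [m+kn]%n≡m%n; m<n⇒m%n≡m; m*n%n≡0)
open import Data.Nat.Properties using (≤-trans; ≤-refl; ≤-reflexive; 1+n≰n; m+[n∸m]≡n; *-suc; m^n>0; *-monoʳ-<; *-mono-≤; *-monoˡ-≤; *-cancelʳ-≡; m≤m+n; m≤n+m; m<m+n; +-cancelˡ-≡; +-monoˡ-≤; +-monoʳ-≤; ∸-monoˡ-≤; ^-monoʳ-≤; ^-distribˡ-+-*) renaming (*-comm to *ℕ-comm; +-assoc to +ℕ-assoc; +-comm to +ℕ-comm; +-suc to +ℕ-suc; suc-injective to suc-injectiveℕ)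
open import Data.Nat.Solver using (module +-*-Solver)
open import Data.Product using (∃; _×_; _,_; proj₁; proj₂)
open import Data.Sum using (_⊎_; inj₁; inj₂; [_,_]′)
open import Data.Vec using (Vec; []; _∷_; replicate)
open import Function using (_∘_)
open import Function.Bundles using (_⇔_; mk⇔)
open import Relation.Binary.Definitions using (WeaklyDecidable)
open import Relation.Binary.PropositionalEquality as ≡ using (_≡_)
open import Relation.Nullary using (¬_; yes; no)
open import Relation.Nullary.Decidable using (_×-dec_; ¬?; decidable-stable)
open import Algebra.Bundles using (RawRing)
open import Algebra.Solver.Ring.AlmostCommutativeRing using (AlmostCommutativeRing; fromCommutativeSemiring; _-Raw-AlmostCommutative⟶_; Induced-equivalence)
import Algebra.Properties.CommutativeMonoid.Sum as MonoidSum
import Algebra.Properties.CommutativeSemiring.Exp as CommExp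
import Algebra.Properties.Group as GroupProperties
import Algebra.Properties.Ring as RingProperties
import Algebra.Properties.Semiring.Exp as Exp
import Algebra.Properties.Semiring.Mult as Mult
import Algebra.Properties.Semiring.Sum as SemiringSum
import Algebra.Solver.Ring as RingSolver
import Relation.Binary.Reasoning.Setoid as SetoidReasoning

-- The factors αᵢD + βᵢN arise because q - 1 is the sum of all 2ⁱ below q: D^(q-1) has one factor
-- D^(2ⁱ) for each binary digit, and weighting by linear factors in f^(q-1) = N/D replaces each D by
-- any member of the pencil of D and N. K is the determinant of the map from (α, β) to the
-- coefficients of v and v³ in αD + βN. If K ≠ 0, inverting the map gives A and B, where one of
-- these coefficients is 1 and the other 0. If K = 0, its kernel contains (a, b), and the letter
-- shrinks to a + bv⁴. The obstacle is that words have unbounded length. A run of A stays tractable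
-- because A fixes e₁ and otherwise only exchanges e₂ and e₃, up to scaling and multiples of e₁. Its
-- effect is stored in two unknowns t and σ, which are eliminated by varying the last letters. The
-- exchange has period two, hence the split by the parity of the length. For even length one
-- elimination leaves a cubic relation between p and r; conjugation fixes p and swaps r and s, and
-- so provides a second one.

-- Fields: cancellation and the number of roots

module FieldProperties {c ℓ} (F : Field c ℓ) where
  open Field F hiding (zero)
  open SetoidReasoning setoid
  open GroupProperties +-group public using () renaming (x∙y⁻¹≈ε⇒x≈y to x-y≈0⇒x≈y)

  1≉0 : ¬ 1# ≈ 0#
  1≉0 1≈0 = 0≉1 (sym 1≈0)

  ⁻¹-inverseˡ : ∀ x (x≉0 : ¬ x ≈ 0#) → (x ⁻¹) x≉0 * x ≈ 1#
  ⁻¹-inverseˡ x x≉0 = trans (*-comm _ x) (⁻¹-inverse x x≉0)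

  *-cancelˡ : ∀ x {y z} → ¬ x ≈ 0# → x * y ≈ x * z → y ≈ z
  *-cancelˡ x {y} {z} x≉0 xy≈xz = begin
    y                     ≈⟨ *-identityˡ y ⟨
    1# * y                ≈⟨ *-congʳ (⁻¹-inverseˡ x x≉0) ⟨
    (x ⁻¹) x≉0 * x * y    ≈⟨ *-assoc _ _ _ ⟩
    (x ⁻¹) x≉0 * (x * y)  ≈⟨ *-congˡ xy≈xz ⟩
    (x ⁻¹) x≉0 * (x * z)  ≈⟨ *-assoc _ _ _ ⟨
    (x ⁻¹) x≉0 * x * z    ≈⟨ *-congʳ (⁻¹-inverseˡ x x≉0) ⟩
    1# * z                ≈⟨ *-identityˡ z ⟩
    z                     ∎

  cancel-factor : ∀ {x y} → ¬ x ≈ 0# → x * y ≈ 0# → y ≈ 0#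
  cancel-factor {x} x≉0 xy≈0 = *-cancelˡ x x≉0 (trans xy≈0 (sym (zeroʳ x)))

  zero-product : ∀ {x y} → x * y ≈ 0# → x ≈ 0# ⊎ y ≈ 0#
  zero-product {x} xy≈0 with x ≟ 0#
  ... | yes x≈0 = inj₁ x≈0
  ... | no  x≉0 = inj₂ (cancel-factor x≉0 xy≈0)

  *-nonzero : ∀ {x y} → ¬ x ≈ 0# → ¬ y ≈ 0# → ¬ x * y ≈ 0#
  *-nonzero x≉0 y≉0 xy≈0 = y≉0 (cancel-factor x≉0 xy≈0)

  ^-nonzero : ∀ {x} n → ¬ x ≈ 0# → ¬ x ^ n ≈ 0#
  ^-nonzero zero    x≉0 = 1≉0
  ^-nonzero (suc n) x≉0 = *-nonzero x≉0 (^-nonzero n x≉0)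

  ^-zero⇒zero : ∀ {x} n → x ^ n ≈ 0# → x ≈ 0#
  ^-zero⇒zero {x} n xⁿ≈0 with x ≟ 0#
  ... | yes x≈0 = x≈0
  ... | no  x≉0 = ⊥-elim (^-nonzero n x≉0 xⁿ≈0)

  ⁻¹-nonzero : ∀ x (x≉0 : ¬ x ≈ 0#) → ¬ (x ⁻¹) x≉0 ≈ 0#
  ⁻¹-nonzero x x≉0 x⁻¹≈0 = 1≉0 (trans (sym (⁻¹-inverse x x≉0)) (trans (*-congˡ x⁻¹≈0) (zeroʳ x)))

  1^ : ∀ n → 1# ^ n ≈ 1#
  1^ zero    = refl
  1^ (suc n) = trans (*-identityˡ _) (1^ n)

  0^ : ∀ {n} → 0 < n → 0# ^ n ≈ 0#
  0^ {suc n} _ = zeroˡ _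

  -- φ is a polynomial function of degree at most N whose coefficient at
  -- degree N is l: its N-fold divided differences are all equal to l.
  HasDegree : Carrier → ℕ → (Carrier → Carrier) → Set _
  HasDegree l zero    φ = ∀ x → φ x ≈ l
  HasDegree l (suc N) φ =
    ∀ α → ∃ λ ψ → HasDegree l N ψ × (∀ x → φ x ≈ φ α + (x - α) * ψ x)

  private
    factor-sum : ∀ A C d B D z → (A + d * B) + z * (C + d * D) ≈ (A + z * C) + d * (B + z * D)
    factor-sum A C d B D z = begin
      (A + d * B) + z * (C + d * D)       ≈⟨ +-congˡ (distribˡ z C (d * D)) ⟩
      (A + d * B) + (z * C + z * (d * D)) ≈⟨ +-assoc A (d * B) _ ⟩
      A + (d * B + (z * C + z * (d * D))) ≈⟨ +-congˡ (+-assoc (d * B) _ _) ⟨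
      A + ((d * B + z * C) + z * (d * D)) ≈⟨ +-congˡ (+-congʳ (+-comm (d * B) _)) ⟩
      A + ((z * C + d * B) + z * (d * D)) ≈⟨ +-congˡ (+-assoc (z * C) _ _) ⟩
      A + (z * C + (d * B + z * (d * D))) ≈⟨ +-assoc A _ _ ⟨
      (A + z * C) + (d * B + z * (d * D)) ≈⟨ +-congˡ (+-congˡ swap) ⟩
      (A + z * C) + (d * B + d * (z * D)) ≈⟨ +-congˡ (distribˡ d B (z * D)) ⟨
      (A + z * C) + d * (B + z * D)       ∎
      where
      swap : z * (d * D) ≈ d * (z * D)
      swap = trans (sym (*-assoc z d D)) (trans (*-congʳ (*-comm z d)) (*-assoc d z D))

    add-back : ∀ x α → α + (x - α) ≈ x
    add-back x α = begin
      α + (x - α)     ≈⟨ +-comm α _ ⟩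
      (x - α) + α     ≈⟨ +-assoc x _ α ⟩
      x + (- α + α)   ≈⟨ +-congˡ (-‿inverseˡ α) ⟩
      x + 0#          ≈⟨ +-identityʳ x ⟩
      x               ∎

  -- The summand χ has degree one less and cannot disturb the leading coefficient `l`; `degree-x*`
  -- needs only this case.
  degree-+ : ∀ {l l′ N φ χ} z → HasDegree l (suc N) φ → HasDegree l′ N χ →
             HasDegree l (suc N) (λ x → φ x + z * χ x)
  degree-+ {N = zero} {φ} {χ} z φ-deg χ-deg α with φ-deg α
  ... | ψ , ψ-deg , φ≈ = ψ , ψ-deg , λ x → begin
    φ x + z * χ x                   ≈⟨ +-cong (φ≈ x) (*-congˡ (trans (χ-deg x) (sym (χ-deg α)))) ⟩
    φ α + (x - α) * ψ x + z * χ α   ≈⟨ +-assoc _ _ _ ⟩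
    φ α + ((x - α) * ψ x + z * χ α) ≈⟨ +-congˡ (+-comm _ _) ⟩
    φ α + (z * χ α + (x - α) * ψ x) ≈⟨ +-assoc _ _ _ ⟨
    φ α + z * χ α + (x - α) * ψ x   ∎
  degree-+ {N = suc N} {φ} {χ} z φ-deg χ-deg α with φ-deg α | χ-deg α
  ... | ψ , ψ-deg , φ≈ | ω , ω-deg , χ≈ = (λ x → ψ x + z * ω x) , degree-+ z ψ-deg ω-deg , λ x →
    trans (+-cong (φ≈ x) (*-congˡ (χ≈ x))) (factor-sum (φ α) (χ α) (x - α) (ψ x) (ω x) z)

  degree-x* : ∀ {l} N {φ} → HasDegree l N φ → HasDegree l (suc N) (λ x → x * φ x)
  degree-x* zero {φ} φ-deg α = φ , φ-deg , λ x → begin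
    x * φ x                     ≈⟨ *-congʳ (add-back x α) ⟨
    (α + (x - α)) * φ x         ≈⟨ distribʳ _ _ _ ⟩
    α * φ x + (x - α) * φ x     ≈⟨ +-congʳ (*-congˡ (trans (φ-deg x) (sym (φ-deg α)))) ⟩
    α * φ α + (x - α) * φ x     ∎
  degree-x* (suc N) {φ} φ-deg α with φ-deg α
  ... | ψ , ψ-deg , φ≈ = (λ x → φ x + α * ψ x) , degree-+ α φ-deg ψ-deg , λ x → begin
    x * φ x                                             ≈⟨ *-congʳ (add-back x α) ⟨
    (α + (x - α)) * φ x                                 ≈⟨ distribʳ _ _ _ ⟩
    α * φ x + (x - α) * φ x                             ≈⟨ +-congʳ (*-congˡ (φ≈ x)) ⟩
    α * (φ α + (x - α) * ψ x) + (x - α) * φ x           ≈⟨ +-congʳ (distribˡ _ _ _) ⟩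
    α * φ α + α * ((x - α) * ψ x) + (x - α) * φ x       ≈⟨ +-assoc _ _ _ ⟩
    α * φ α + (α * ((x - α) * ψ x) + (x - α) * φ x)     ≈⟨ +-congˡ (+-comm _ _) ⟩
    α * φ α + ((x - α) * φ x + α * ((x - α) * ψ x))     ≈⟨ +-congˡ (+-congˡ (trans (sym (*-assoc _ _ _)) (trans
        (*-congʳ (*-comm _ _)) (*-assoc _ _ _)))) ⟩
    α * φ α + ((x - α) * φ x + (x - α) * (α * ψ x))     ≈⟨ +-congˡ (distribˡ _ _ _) ⟨
    α * φ α + (x - α) * (φ x + α * ψ x)                 ∎

  degree-^ : ∀ N → HasDegree 1# N (_^ N)
  degree-^ zero    x = refl
  degree-^ (suc N) = degree-x* N (degree-^ N)

  private
    quotient-root : ∀ {φx φα d ψx} → φx ≈ φα → ¬ d ≈ 0# → φx ≈ φα + d * ψx → ψx ≈ 0#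
    quotient-root {φx} {φα} {d} {ψx} φx≈φα d≉0 eq = cancel-factor d≉0 (begin
      d * ψx                   ≈⟨ +-identityˡ _ ⟨
      0# + d * ψx              ≈⟨ +-congʳ (-‿inverseˡ φα) ⟨
      - φα + φα + d * ψx       ≈⟨ +-assoc _ _ _ ⟩
      - φα + (φα + d * ψx)     ≈⟨ +-congˡ (trans (sym eq) φx≈φα) ⟩
      - φα + φα                ≈⟨ -‿inverseˡ φα ⟩
      0#                       ∎)

    difference-nonzero : ∀ {m} (e : Fin (suc m) → Carrier) → (∀ i j → e i ≈ e j → i ≡ j) →
                         ∀ i → ¬ e (suc i) - e zero ≈ 0#
    difference-nonzero e e-inj i d≈0 with e-inj _ _ (x-y≈0⇒x≈y _ _ d≈0)
    ... | ()

  -- The quotient by the factor of one root vanishes at all the others; after N divisions the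
  -- constant `l` is left with a root.
  too-many-roots : ∀ {l} N {φ} → HasDegree l N φ → (e : Fin (suc N) → Carrier) →
                   (∀ i j → e i ≈ e j → i ≡ j) → (∀ i → φ (e i) ≈ 0#) → l ≈ 0#
  too-many-roots zero    φ-deg e e-inj root = trans (sym (φ-deg (e zero))) (root zero)
  too-many-roots (suc N) φ-deg e e-inj root with φ-deg (e zero)
  ... | ψ , ψ-deg , φ≈ = too-many-roots N ψ-deg (e ∘ suc) (λ i j eq → suc-injective (e-inj _ _ eq)) λ i →
    quotient-root (trans (root (suc i)) (sym (root zero))) (difference-nonzero e e-inj i) (φ≈ (e (suc i)))

  -- The divided difference of x^N at the first root already removes the constant 1, so x^N - 1 need
  -- not be formed.
  too-many-roots-of-unity : ∀ {N} → 0 < N → (e : Fin (suc N) → Carrier) →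
    (∀ i j → e i ≈ e j → i ≡ j) → ¬ (∀ i → e i ^ N ≈ 1#)
  too-many-roots-of-unity {suc N} _ e e-inj root with degree-^ (suc N) (e zero)
  ... | ψ , ψ-deg , φ≈ = 1≉0 (too-many-roots N ψ-deg (e ∘ suc) (λ i j eq → suc-injective (e-inj _ _ eq)) λ i →
    quotient-root (trans (root (suc i)) (sym (root zero))) (difference-nonzero e e-inj i) (φ≈ (e (suc i))))

-- Finite fields: reindexing, Fermat's theorem, power sums

module FiniteField {c ℓ} (F : Field c ℓ) {n : ℕ} (hasCardinality : HasCardinality F (suc n)) where
  open Field F hiding (zero)
  open HasCardinality hasCardinality
  open FieldProperties F
  open SetoidReasoning setoid
  open RingProperties ring using (x[y-z]≈xy-xz)
  open Exp semiring using (^-congˡ)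
  open CommExp commutativeSemiring using (^-distrib-*)
  open SemiringSum semiring using (sum; sum-cong-≋; sum-replicate; sum-remove; sum-permute; ∑-distrib-+;
      *-distribˡ-sum)
  open Mult semiring using () renaming (_×_ to _·_)
  module Product = MonoidSum *-commutativeMonoid

  index : Carrier → Fin (suc n)
  index x = proj₁ (enum-surj x)

  enum-index : ∀ x → enum (index x) ≈ x
  enum-index x = proj₂ (enum-surj x)

  injective⇒permutation : ∀ {g} → (∀ {x y} → x ≈ y → g x ≈ g y) →
                          (∀ x y → g x ≈ g y → x ≈ y) → IsPermutation F g
  injective⇒permutation {g} g-cong g-inj = g-inj , surjective
    where
    -- If y is not a value of g, then i ↦ g (enum i) injects Fin (suc n) into Fin n.
    surjective : ∀ y → ∃ λ x → g x ≈ y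
    surjective y with any? (λ i → g (enum i) ≟ y)
    ... | yes (i , gi≈y) = enum i , gi≈y
    ... | no  ∄i = ⊥-elim (1+n≰n (injective⇒≤ {f = h} h-inj))
      where
      missed : ∀ i → ¬ index y ≡ index (g (enum i))
      missed i eq = ∄i (i , trans (sym (enum-index _)) (trans (reflexive (≡.cong enum (≡.sym eq))) (enum-index y)))
      h : Fin (suc n) → Fin n
      h i = punchOut (missed i)
      h-inj : ∀ {i j} → h i ≡ h j → i ≡ j
      h-inj {i} {j} eq = enum-inj i j (g-inj _ _ (trans (sym (enum-index _))
        (trans (reflexive (≡.cong enum (punchOut-injective (missed i) (missed j) eq))) (enum-index _))))

  opaque
    ∑ : (Carrier → Carrier) → Carrier
    ∑ φ = sum (λ i → φ (enum i))

    ∑-cong : ∀ {φ ψ} → (∀ x → φ x ≈ ψ x) → ∑ φ ≈ ∑ ψ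
    ∑-cong φ≈ψ = sum-cong-≋ (λ i → φ≈ψ (enum i))

    ∑-+ : ∀ φ ψ → ∑ (λ x → φ x + ψ x) ≈ ∑ φ + ∑ ψ
    ∑-+ φ ψ = ∑-distrib-+ (φ ∘ enum) (ψ ∘ enum)

    ∑-* : ∀ z φ → ∑ (λ x → z * φ x) ≈ z * ∑ φ
    ∑-* z φ = sym (*-distribˡ-sum z (φ ∘ enum))

    ∑-1 : ∑ (λ _ → 1#) ≈ suc n · 1#
    ∑-1 = sum-replicate (suc n)

  module _ {g : Carrier → Carrier} (g-cong : ∀ {x y} → x ≈ y → g x ≈ g y) (g-perm : IsPermutation F g) where
    private
      g⁻¹ : Carrier → Carrier
      g⁻¹ y = proj₁ (proj₂ g-perm y)

    indexPermutation : Permutation′ (suc n)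
    indexPermutation = permutation (λ i → index (g (enum i))) (λ i → index (g⁻¹ (enum i))) invˡ invʳ
      where
      invˡ : ∀ i → index (g (enum (index (g⁻¹ (enum i))))) ≡ i
      invˡ i = enum-inj _ _ (begin
        enum (index (g (enum (index (g⁻¹ (enum i)))))) ≈⟨ enum-index _ ⟩
        g (enum (index (g⁻¹ (enum i))))                ≈⟨ g-cong (enum-index _) ⟩
        g (g⁻¹ (enum i))                               ≈⟨ proj₂ (proj₂ g-perm (enum i)) ⟩
        enum i                                         ∎)
      invʳ : ∀ i → index (g⁻¹ (enum (index (g (enum i))))) ≡ i
      invʳ i = enum-inj _ _ (trans (enum-index _) (proj₁ g-perm _ _
        (trans (proj₂ (proj₂ g-perm _)) (enum-index _))))

    opaque
      unfolding ∑

      ∑-reindex : ∀ φ → (∀ {x y} → x ≈ y → φ x ≈ φ y) → ∑ φ ≈ ∑ (φ ∘ g)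
      ∑-reindex φ φ-cong = trans (sum-permute (φ ∘ enum) indexPermutation)
        (sum-cong-≋ (λ i → φ-cong (enum-index (g (enum i)))))

    ∏-reindex : ∀ φ → (∀ {x y} → x ≈ y → φ x ≈ φ y) →
                Product.sum (λ i → φ (enum i)) ≈ Product.sum (λ i → φ (g (enum i)))
    ∏-reindex φ φ-cong = trans (Product.sum-permute (φ ∘ enum) indexPermutation)
      (Product.sum-cong-≋ (λ i → φ-cong (enum-index (g (enum i)))))

  +1-permutation : IsPermutation F (_+ 1#)
  +1-permutation = injective⇒permutation +-congʳ λ x y eq →
    trans (sym (cancel x)) (trans (+-congʳ eq) (cancel y))
    where
    cancel : ∀ x → x + 1# - 1# ≈ x
    cancel x = trans (+-assoc x 1# _) (trans (+-congˡ (-‿inverseʳ 1#)) (+-identityʳ x))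

  *-permutation : ∀ {y} → ¬ y ≈ 0# → IsPermutation F (y *_)
  *-permutation {y} y≉0 = injective⇒permutation *-congˡ λ _ _ → *-cancelˡ y y≉0

  -- Translation by 1 permutes the field, so the sum of all elements does not change when 1 is added
  -- to each.
  cardinality≈0 : suc n · 1# ≈ 0#
  cardinality≈0 = begin
    N                   ≈⟨ +-identityˡ N ⟨
    0# + N              ≈⟨ +-congʳ (-‿inverseˡ Σx) ⟨
    - Σx + Σx + N       ≈⟨ +-assoc _ _ _ ⟩
    - Σx + (Σx + N)     ≈⟨ +-congˡ Σx+N≈Σx ⟩
    - Σx + Σx           ≈⟨ -‿inverseˡ Σx ⟩
    0#                  ∎
    where
    N Σx : Carrier
    N = suc n · 1#
    Σx = ∑ (λ x → x)
    Σx+N≈Σx : Σx + N ≈ Σx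
    Σx+N≈Σx = begin
      Σx + N                 ≈⟨ +-congˡ ∑-1 ⟨
      Σx + ∑ (λ _ → 1#)      ≈⟨ ∑-+ (λ x → x) (λ _ → 1#) ⟨
      ∑ (λ x → x + 1#)       ≈⟨ ∑-reindex +-congʳ +1-permutation (λ x → x) (λ eq → eq) ⟨
      Σx                     ∎

  private
    0ᵢ : Fin (suc n)
    0ᵢ = index 0#

    nonzero-away : ∀ i → ¬ enum (punchIn 0ᵢ i) ≈ 0#
    nonzero-away i eq = punchInᵢ≢i 0ᵢ i (enum-inj _ _ (trans eq (sym (enum-index 0#))))

    -- With the factor at 0 replaced by 1, a product over the nonzero elements becomes one over the
    -- whole field, which can be reindexed.
    unit : Carrier → Carrier → Carrier
    unit u x with x ≟ 0#
    ... | yes _ = 1#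
    ... | no  _ = u

    unit-zero : ∀ u {x} → x ≈ 0# → unit u x ≈ 1#
    unit-zero u {x} x≈0 with x ≟ 0#
    ... | yes _ = refl
    ... | no x≉0 = ⊥-elim (x≉0 x≈0)

    unit-nonzero : ∀ u {x} → ¬ x ≈ 0# → unit u x ≈ u
    unit-nonzero u {x} x≉0 with x ≟ 0#
    ... | yes x≈0 = ⊥-elim (x≉0 x≈0)
    ... | no  _ = refl

    ∏ : (Carrier → Carrier) → Carrier
    ∏ φ = Product.sum (λ i → φ (enum i))

  -- Multiplication by y permutes the field, so that the product of the
  -- nonzero elements absorbs a factor y for each of them.
  x^n≈1 : ∀ {y} → ¬ y ≈ 0# → y ^ n ≈ 1#
  x^n≈1 {y} y≉0 = *-cancelˡ P P≉0 (begin
    P * y ^ n                           ≈⟨ *-congˡ yⁿ ⟩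
    P * ∏ (unit y)                      ≈⟨ Product.∑-distrib-+ (λ i → unit′ (enum i)) (λ i → unit y (enum i)) ⟨
    ∏ (λ x → unit′ x * unit y x)        ≈⟨ Product.sum-cong-≋ (λ i → step (enum i)) ⟩
    ∏ (λ x → unit′ (y * x))             ≈⟨ ∏-reindex *-congˡ (*-permutation y≉0) unit′ unit′-cong ⟨
    P                                   ≈⟨ *-identityʳ P ⟨
    P * 1#                              ∎)
    where
    unit′ : Carrier → Carrier
    unit′ x = unit x x
    unit′-cong : ∀ {x z} → x ≈ z → unit′ x ≈ unit′ z
    unit′-cong {x} {z} x≈z with x ≟ 0#
    ... | yes x≈0 = sym (unit-zero z (trans (sym x≈z) x≈0))
    ... | no  x≉0 = trans x≈z (sym (unit-nonzero z (λ z≈0 → x≉0 (trans x≈z z≈0))))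
    P : Carrier
    P = ∏ unit′
    unit′-nonzero : ∀ x → ¬ unit′ x ≈ 0#
    unit′-nonzero x with x ≟ 0#
    ... | yes _ = 1≉0
    ... | no x≉0 = x≉0
    product-nonzero : ∀ {m} (t : Fin m → Carrier) → (∀ i → ¬ t i ≈ 0#) → ¬ Product.sum t ≈ 0#
    product-nonzero {zero}  t t≉0 = 1≉0
    product-nonzero {suc m} t t≉0 = *-nonzero (t≉0 zero) (product-nonzero (t ∘ suc) (t≉0 ∘ suc))
    P≉0 : ¬ P ≈ 0#
    P≉0 = product-nonzero (unit′ ∘ enum) (unit′-nonzero ∘ enum)
    yⁿ : y ^ n ≈ ∏ (unit y)
    yⁿ = begin
      y ^ n                                                         ≈⟨ Product.sum-replicate n ⟨
      Product.sum {n} (λ _ → y)                                     ≈⟨ Product.sum-cong-≋ (λ i → unit-nonzero y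
          (nonzero-away i)) ⟨
      Product.sum (λ i → unit y (enum (punchIn 0ᵢ i)))              ≈⟨ *-identityˡ _ ⟨
      1# * Product.sum (λ i → unit y (enum (punchIn 0ᵢ i)))         ≈⟨ *-congʳ (unit-zero y (enum-index 0#)) ⟨
      unit y (enum 0ᵢ) * Product.sum (λ i → unit y (enum (punchIn 0ᵢ i))) ≈⟨ Product.sum-remove (λ i → unit y
          (enum i)) ⟨
      ∏ (unit y)                                                    ∎
    step : ∀ x → unit′ x * unit y x ≈ unit′ (y * x)
    step x with x ≟ 0#
    ... | yes x≈0 = trans (*-identityˡ 1#) (sym (unit-zero (y * x) (trans (*-congˡ x≈0) (zeroʳ y))))
    ... | no  x≉0 = trans (*-comm x y) (sym (unit-nonzero (y * x) (*-nonzero y≉0 x≉0)))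

  x^[1+n]≈x : ∀ x → x ^ suc n ≈ x
  x^[1+n]≈x x with x ≟ 0#
  ... | yes x≈0 = trans (*-congʳ x≈0) (trans (zeroˡ _) (sym x≈0))
  ... | no  x≉0 = trans (*-congˡ (x^n≈1 x≉0)) (*-identityʳ x)

  -- Counting roots of x^N - 1 takes the place of a generator of the multiplicative group.
  ∃-nonroot-of-unity : ∀ {N} → 0 < N → N < n → ∃ λ y → ¬ y ≈ 0# × ¬ y ^ N ≈ 1#
  ∃-nonroot-of-unity {N} 0<N N<n with any? (λ i → ¬? (enum i ≟ 0#) ×-dec ¬? ((enum i ^ N) ≟ 1#))
  ... | yes (i , p) = enum i , p
  ... | no ∄i = ⊥-elim (too-many-roots-of-unity 0<N e e-inj root)
    where
    e : Fin (suc N) → Carrier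
    e i = enum (punchIn 0ᵢ (inject≤ i N<n))
    e-inj : ∀ i j → e i ≈ e j → i ≡ j
    e-inj i j eq = inject≤-injective N<n N<n i j (punchIn-injective 0ᵢ _ _ (enum-inj _ _ eq))
    root : ∀ i → e i ^ N ≈ 1#
    root i = decidable-stable (_ ≟ _) (λ ≉1 → ∄i (_ , nonzero-away _ , ≉1))

  -- Replacing x by yx permutes the field and multiplies the sum by y^N ≠ 1.
  ∑-^-zero : ∀ {y} N → ¬ y ≈ 0# → ¬ y ^ N ≈ 1# → ∑ (_^ N) ≈ 0#
  ∑-^-zero {y} N y≉0 yᴺ≉1 = cancel-factor (λ eq → yᴺ≉1 (x-y≈0⇒x≈y _ _ eq)) (begin
    (y ^ N - 1#) * S         ≈⟨ *-comm _ S ⟩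
    S * (y ^ N - 1#)         ≈⟨ x[y-z]≈xy-xz S _ _ ⟩
    S * y ^ N - S * 1#       ≈⟨ +-cong (*-comm S _) (-‿cong (*-identityʳ S)) ⟩
    y ^ N * S - S            ≈⟨ +-congʳ (∑-* (y ^ N) (_^ N)) ⟨
    ∑ (λ x → y ^ N * x ^ N) - S ≈⟨ +-congʳ (∑-cong (λ x → ^-distrib-* y x N)) ⟨
    ∑ (λ x → (y * x) ^ N) - S ≈⟨ +-congʳ (∑-reindex *-congˡ (*-permutation y≉0) (_^ N) (^-congˡ N)) ⟨
    S - S                    ≈⟨ -‿inverseʳ S ⟩
    0#                       ∎)
    where
    S : Carrier
    S = ∑ (_^ N)

  opaque
    unfolding ∑

    ∑-nonzero-constant : ∀ {φ} → φ 0# ≈ 0# → (∀ {x y} → x ≈ y → φ x ≈ φ y) →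
                         (∀ x → ¬ x ≈ 0# → φ x ≈ 1#) → ∑ φ ≈ n · 1#
    ∑-nonzero-constant {φ} φ0≈0 φ-cong φ≈1 = begin
      ∑ φ                                               ≈⟨ sum-remove (φ ∘ enum) ⟩
      φ (enum 0ᵢ) + sum (λ i → φ (enum (punchIn 0ᵢ i))) ≈⟨ +-congʳ (trans (φ-cong (enum-index 0#)) φ0≈0) ⟩
      0# + sum (λ i → φ (enum (punchIn 0ᵢ i)))          ≈⟨ +-identityˡ _ ⟩
      sum (λ i → φ (enum (punchIn 0ᵢ i)))               ≈⟨ sum-cong-≋ (λ i → φ≈1 _ (nonzero-away i)) ⟩
      sum {n} (λ _ → 1#)                                ≈⟨ sum-replicate n ⟩
      n · 1#                                            ∎

-- Characteristic two, and the elimination for even length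

module CharacteristicTwo {c ℓ} (F : Field c ℓ) (1+1≈0 : Field._≈_ F (Field._+_ F (Field.1# F) (Field.1# F))
    (Field.0# F)) where
  open Field F hiding (zero)
  open FieldProperties F
  open SetoidReasoning setoid
  open Exp semiring using (^-congˡ; ^-congʳ; ^-assocʳ)

  private
    -- With coefficients in 𝔽₂ the solver cancels equal terms in pairs, so its identities may use 1
    -- + 1 = 0.
    𝔽₂ : RawRing _ _
    𝔽₂ = record { Carrier = Bool ; _≈_ = _≡_ ; _+_ = _xor_ ; _*_ = _∧_ ; -_ = λ x → x ; 0# = false ; 1# = true }

    almostRing : AlmostCommutativeRing _ _
    almostRing = fromCommutativeSemiring commutativeSemiring

    embed : Bool → Carrier
    embed false = 0#
    embed true  = 1#

    embedding : 𝔽₂ -Raw-AlmostCommutative⟶ almostRing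
    embedding = record
      { ⟦_⟧    = embed
      ; +-homo = λ { false y → sym (+-identityˡ _) ; true false → sym (+-identityʳ _) ; true true → sym 1+1≈0 }
      ; *-homo = λ { false y → sym (zeroˡ _) ; true y → sym (*-identityˡ _) }
      ; -‿homo = λ _ → refl
      ; 0-homo = refl
      ; 1-homo = refl
      }

    _≟₂_ : WeaklyDecidable (Induced-equivalence embedding)
    false ≟₂ false = just refl
    true  ≟₂ true  = just refl
    _     ≟₂ _     = nothing

  open RingSolver 𝔽₂ almostRing embedding _≟₂_ public using (Polynomial; solve; _:=_; _:+_; _:*_; _:^_; con)

  x+x≈0 : ∀ x → x + x ≈ 0#
  x+x≈0 = solve 1 (λ x → x :+ x := con false) refl

  x+y≈0⇒x≈y : ∀ {x y} → x + y ≈ 0# → x ≈ y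
  x+y≈0⇒x≈y {x} {y} x+y≈0 = begin
    x           ≈⟨ solve 2 (λ x y → x := (x :+ y) :+ y) refl x y ⟩
    x + y + y   ≈⟨ +-congʳ x+y≈0 ⟩
    0# + y      ≈⟨ +-identityˡ y ⟩
    y           ∎

  x≈y⇒x+y≈0 : ∀ {x y} → x ≈ y → x + y ≈ 0#
  x≈y⇒x+y≈0 {x} {y} x≈y = trans (+-congʳ x≈y) (x+x≈0 y)

  infixr 6 _⊹_
  -- Together with `_⊛_` this forms ideal-membership certificates: the solver writes a term as a
  -- combination of relations, and these operators add up their vanishing.
  _⊹_ : ∀ {x y} → x ≈ 0# → y ≈ 0# → x + y ≈ 0#
  x≈0 ⊹ y≈0 = trans (+-cong x≈0 y≈0) (+-identityˡ 0#)

  infixr 7 _⊛_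
  _⊛_ : ∀ {x} z → x ≈ 0# → z * x ≈ 0#
  z ⊛ x≈0 = trans (*-congˡ x≈0) (zeroʳ z)

  frobenius : ∀ n x y → (x + y) ^ (2 ^ℕ n) ≈ x ^ (2 ^ℕ n) + y ^ (2 ^ℕ n)
  ^2^suc : ∀ n x → x ^ (2 ^ℕ suc n) ≈ (x ^ (2 ^ℕ n)) ^ 2

  ^2^suc n x = begin
    x ^ (2 *ℕ 2 ^ℕ n)     ≈⟨ ^-congʳ x (*ℕ-comm 2 (2 ^ℕ n)) ⟩
    x ^ (2 ^ℕ n *ℕ 2)     ≈⟨ ^-assocʳ x (2 ^ℕ n) 2 ⟨
    (x ^ (2 ^ℕ n)) ^ 2    ∎

  frobenius zero    x y = solve 2 (λ x y → (x :+ y) :^ 1 := x :^ 1 :+ y :^ 1) refl x y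
  frobenius (suc n) x y = begin
    (x + y) ^ (2 ^ℕ suc n)                     ≈⟨ ^2^suc n (x + y) ⟩
    ((x + y) ^ (2 ^ℕ n)) ^ 2                   ≈⟨ ^-congˡ 2 (frobenius n x y) ⟩
    (x ^ (2 ^ℕ n) + y ^ (2 ^ℕ n)) ^ 2          ≈⟨ solve 2 (λ x y → (x :+ y) :^ 2 := x :^ 2 :+ y :^ 2) refl _ _ ⟩
    (x ^ (2 ^ℕ n)) ^ 2 + (y ^ (2 ^ℕ n)) ^ 2    ≈⟨ +-cong (^2^suc n x) (^2^suc n y) ⟨
    x ^ (2 ^ℕ suc n) + y ^ (2 ^ℕ suc n)        ∎

  frobenius-injective : ∀ n {x y} → x ^ (2 ^ℕ n) ≈ y ^ (2 ^ℕ n) → x ≈ y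
  frobenius-injective n {x} {y} eq =
    x+y≈0⇒x≈y (^-zero⇒zero (2 ^ℕ n) (trans (frobenius n x y) (x≈y⇒x+y≈0 eq)))

  -- The hypotheses are the traces of the words A^(k-2)BB, A^(k-3)BBA, A^(k-3)BBB and, in
  -- `contradiction`, A^(k-1)B and A^(k-3)BAB; p, r, s are taken at the level of the digit k - 3.
  module EvenCase
    {p r s T S Q : Carrier}
    (p≉0 : ¬ p ≈ 0#) (r≉0 : ¬ r ≈ 0#) (Q≉0 : ¬ Q ≈ 0#)
    (eq₄ : p ^ 4 + r ^ 2 * S + r ^ 4 * T ^ 2 ≈ 0#)
    (eq₇ : p ^ 2 * T + S + r ^ 2 * (T ^ 2 + p * Q) + p ^ 4 * r * Q ≈ 0#)
    (eq₈ : p ^ 2 + r ^ 2 * T + r ^ 5 * Q ≈ 0#)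
    where

    -- S and T cancel in r² `eq₇` + `eq₄` + p² `eq₈`; what remains is p r³ Q times the cubic.
    cubic : p * r ^ 2 + r + p ^ 3 ≈ 0#
    cubic = cancel-factor (*-nonzero (*-nonzero p≉0 (^-nonzero 3 r≉0)) Q≉0)
      (trans (solve 5 (λ p r T S Q → p :* r :^ 3 :* Q :* (p :* r :^ 2 :+ r :+ p :^ 3) :=
          r :^ 2 :* (p :^ 2 :* T :+ S :+ r :^ 2 :* (T :^ 2 :+ p :* Q) :+ p :^ 4 :* r :* Q)
          :+ (con true :* (p :^ 4 :+ r :^ 2 :* S :+ r :^ 4 :* T :^ 2)
          :+ p :^ 2 :* (p :^ 2 :+ r :^ 2 :* T :+ r :^ 5 :* Q))) refl p r T S Q)
        (r ^ 2 ⊛ eq₇ ⊹ 1# ⊛ eq₄ ⊹ p ^ 2 ⊛ eq₈))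

    contradiction : ¬ p ^ 2 + r * s ≈ 0# → p * s ^ 2 + s + p ^ 3 ≈ 0# →
      S ^ 2 + s * Q ≈ 0# →
      T + p ^ 2 * S + r ^ 4 * S ^ 2 ≈ 0# →
      s ^ 2 + p ^ 2 * T + r ^ 4 * p * Q ≈ 0# → ⊥
    contradiction p²+rs≉0 cubic′ S²+sQ≈0 eq₂ eq₆ =
      [ y≉1 , y²+y+1≉0 ]′ (zero-product {y + 1#} {y ^ 2 + y + 1#}
        (trans (solve 1 (λ y → (y :+ con true) :* (y :^ 2 :+ y :+ con true) := y :^ 3 :+ con true) refl y) y³+1≈0))
      where
      y : Carrier
      y = r ^ 5 * Q

      -- r and s are the roots of p X² + X + p³; distinct roots would have product p².
      r+s≈0 : r + s ≈ 0#
      r+s≈0 = [ (λ eq → eq) , (λ eq → ⊥-elim (p²+rs≉0 (cancel-factor p≉0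
          (trans (solve 3 (λ p r s → p :* (p :^ 2 :+ r :* s) :=
              r :* (p :* (r :+ s) :+ con true) :+ (p :* r :^ 2 :+ r :+ p :^ 3)) refl p r s)
            (r ⊛ eq ⊹ cubic))))) ]′
        (zero-product {r + s} {p * (r + s) + 1#}
          (trans (solve 3 (λ p r s → (r :+ s) :* (p :* (r :+ s) :+ con true) :=
              (p :* r :^ 2 :+ r :+ p :^ 3) :+ (p :* s :^ 2 :+ s :+ p :^ 3)) refl p r s)
            (cubic ⊹ cubic′)))

      s≈r : s ≈ r
      s≈r = sym (x+y≈0⇒x≈y r+s≈0)

      p+r≉0 : ¬ p + r ≈ 0#
      p+r≉0 p+r≈0 = p²+rs≉0
        (trans (solve 3 (λ p r s → p :^ 2 :+ r :* s := (p :+ r) :* (p :+ r) :+ r :* (r :+ s)) refl p r s)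
          ((p + r) ⊛ p+r≈0 ⊹ r ⊛ r+s≈0))

      S²+rQ≈0 : S ^ 2 + r * Q ≈ 0#
      S²+rQ≈0 = trans (+-congˡ (*-congʳ (sym s≈r))) S²+sQ≈0

      eq₆′ : r ^ 2 + p ^ 2 * T + r ^ 4 * p * Q ≈ 0#
      eq₆′ = trans (+-congʳ (+-congʳ (^-congˡ 2 (sym s≈r)))) eq₆

      -- The square of `eq₈` contains the terms p⁴ and r⁴T² of `eq₄`, so adding it removes T.
      S+r⁸Q²≈0 : S + r ^ 8 * Q ^ 2 ≈ 0#
      S+r⁸Q²≈0 = cancel-factor (^-nonzero 2 r≉0)
        (trans (solve 5 (λ p r T S Q → r :^ 2 :* (S :+ r :^ 8 :* Q :^ 2) :=
            (p :^ 4 :+ r :^ 2 :* S :+ r :^ 4 :* T :^ 2)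
            :+ (p :^ 2 :+ r :^ 2 :* T :+ r :^ 5 :* Q) :* (p :^ 2 :+ r :^ 2 :* T :+ r :^ 5 :* Q)) refl p r T S Q)
          (eq₄ ⊹ (p ^ 2 + r ^ 2 * T + r ^ 5 * Q) ⊛ eq₈))

      y³+1≈0 : y ^ 3 + 1# ≈ 0#
      y³+1≈0 = cancel-factor (*-nonzero r≉0 Q≉0)
        (trans (solve 3 (λ r S Q → r :* Q :* ((r :^ 5 :* Q) :^ 3 :+ con true) :=
            (S :+ r :^ 8 :* Q :^ 2) :* (S :+ r :^ 8 :* Q :^ 2) :+ (S :^ 2 :+ r :* Q)) refl r S Q)
          ((S + r ^ 8 * Q ^ 2) ⊛ S+r⁸Q²≈0 ⊹ S²+rQ≈0))

      relation : p ^ 2 + y + p ^ 2 * y ^ 2 + r ^ 2 * y ≈ 0#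
      relation = trans (solve 5 (λ p r T S Q →
          p :^ 2 :+ r :^ 5 :* Q :+ p :^ 2 :* (r :^ 5 :* Q) :^ 2 :+ r :^ 2 :* (r :^ 5 :* Q) :=
          (p :^ 2 :+ r :^ 2 :* T :+ r :^ 5 :* Q)
          :+ (r :^ 2 :* (T :+ p :^ 2 :* S :+ r :^ 4 :* S :^ 2)
          :+ ((p :^ 2 :* r :^ 2) :* (S :+ r :^ 8 :* Q :^ 2)
          :+ r :^ 6 :* (S :^ 2 :+ r :* Q)))) refl p r T S Q)
        (eq₈ ⊹ r ^ 2 ⊛ eq₂ ⊹ (p ^ 2 * r ^ 2) ⊛ S+r⁸Q²≈0 ⊹ r ^ 6 ⊛ S²+rQ≈0)

      [p+r]³+py≈0 : (p + r) ^ 3 + p * y ≈ 0#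
      [p+r]³+py≈0 = cancel-factor p+r≉0
        (trans (solve 4 (λ p r T Q → (p :+ r) :* ((p :+ r) :^ 3 :+ p :* (r :^ 5 :* Q)) :=
            r :^ 2 :* (r :^ 2 :+ p :^ 2 :* T :+ r :^ 4 :* p :* Q)
            :+ p :^ 2 :* (p :^ 2 :+ r :^ 2 :* T :+ r :^ 5 :* Q)) refl p r T Q)
          (r ^ 2 ⊛ eq₆′ ⊹ p ^ 2 ⊛ eq₈))

      y≉1 : ¬ y + 1# ≈ 0#
      -- At r = y = 1 the two relations become p³ + p + 1 and p³ + p² + 1, which are coprime over 𝔽₂
      -- with Bézout cofactors p and p + 1.
      y≉1 y+1≈0 = 1≉0
        (trans (solve 3 (λ p r y → con true :=
            p :* (p :* r :^ 2 :+ r :+ p :^ 3)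
            :+ ((p :+ con true) :* ((p :+ r) :^ 3 :+ p :* y)
            :+ ((p :* (p :* (r :+ con true) :+ con true)
                 :+ (p :+ con true) :* ((p :+ r) :^ 2 :+ (p :+ r) :* (p :+ con true) :+ (p :+ con true) :^ 2))
                     :* (r :+ con true)
            :+ ((p :+ con true) :* p) :* (y :+ con true)))) refl p r y)
          (p ⊛ cubic ⊹ (p + 1#) ⊛ [p+r]³+py≈0 ⊹ _ ⊛ r+1≈0 ⊹ ((p + 1#) * p) ⊛ y+1≈0))
        where
        r+1≈0 : r + 1# ≈ 0#
        r+1≈0 = ^-zero⇒zero 2
          (trans (solve 3 (λ p r y → (r :+ con true) :^ 2 :=
              (p :^ 2 :+ y :+ p :^ 2 :* y :^ 2 :+ r :^ 2 :* y)
              :+ (con true :+ p :^ 2 :* (y :+ con true) :+ r :^ 2) :* (y :+ con true)) refl p r y)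
            (relation ⊹ (1# + p ^ 2 * (y + 1#) + r ^ 2) ⊛ y+1≈0))

      y²+y+1≉0 : ¬ y ^ 2 + y + 1# ≈ 0#
      y²+y+1≉0 eq = p+r≉0
        (trans (solve 2 (λ p r → p :+ r := (p :* r :^ 2 :+ r :+ p :^ 3) :+ (p :* (p :+ r :+ con true)) :* (p :+
            r :+ con true)) refl p r)
          (cubic ⊹ (p * (p + r + 1#)) ⊛ p+r+1≈0))
        where
        y≉0 : ¬ y ≈ 0#
        y≉0 = *-nonzero (^-nonzero 5 r≉0) Q≉0
        -- As 1 + y² = y here, `relation` becomes y (p + r + 1)².
        p+r+1≈0 : p + r + 1# ≈ 0#
        p+r+1≈0 = ^-zero⇒zero 2 (cancel-factor y≉0
          (trans (solve 3 (λ p r y → y :* (p :+ r :+ con true) :^ 2 :=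
              (p :^ 2 :+ y :+ p :^ 2 :* y :^ 2 :+ r :^ 2 :* y) :+ p :^ 2 :* (y :^ 2 :+ y :+ con true)) refl p r y)
            (relation ⊹ p ^ 2 ⊛ eq)))

-- The extension of degree two and its conjugation

q²≡1+[q-1][q+1] : ∀ q → 0 < q → q *ℕ q ≡ suc ((q ∸ 1) *ℕ suc q)
q²≡1+[q-1][q+1] (suc p) _ = ≡.cong suc (≡.sym (*-suc p (suc p)))

module QuadraticExtension {c ℓ} (F : Field c ℓ) (k : ℕ) (hasCardinality : HasCardinality F (2 ^ℕ suc k *ℕ 2 ^ℕ
    suc k)) where
  open Field F hiding (zero)
  open FieldProperties F public
  open SetoidReasoning setoid
  open Exp semiring using (^-congˡ; ^-congʳ; ^-assocʳ)
  open CommExp commutativeSemiring using (^-distrib-*)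
  open Mult semiring using (×-congˡ; ×1-homo-*) renaming (_×_ to _·_)

  q q-1 n : ℕ
  q = 2 ^ℕ suc k
  q-1 = q ∸ 1
  n = q-1 *ℕ suc q

  0<q : 0 < q
  0<q = m^n>0 2 (suc k)

  1+[q-1]≡q : suc q-1 ≡ q
  1+[q-1]≡q = m+[n∸m]≡n 0<q

  0<q-1 : 0 < q-1
  0<q-1 = ∸-monoˡ-≤ 1 (^-monoʳ-≤ 2 (s≤s (z≤n {k})))

  q-1<n : q-1 < n
  q-1<n = ≡.subst (q-1 <_) (≡.sym (*-suc q-1 q)) (m<m+n q-1 (*-mono-≤ 0<q-1 0<q))

  q²≡1+n : q *ℕ q ≡ suc n
  q²≡1+n = q²≡1+[q-1][q+1] q 0<q

  open FiniteField F {n} (≡.subst (HasCardinality F) q²≡1+n hasCardinality) public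

  -- The cardinality is a power of 2 and vanishes in the field, whereas powers of a nonzero 1 + 1
  -- would not.
  1+1≈0 : 1# + 1# ≈ 0#
  1+1≈0 with (1# + 1#) ≟ 0#
  ... | yes 1+1≈0 = 1+1≈0
  ... | no  1+1≉0 = ⊥-elim (powers-nonzero (suc k +ℕ suc k) (trans (×-congˡ (≡.trans (^-distribˡ-+-* 2 (suc k)
      (suc k)) q²≡1+n)) cardinality≈0))
    where
    powers-nonzero : ∀ m → ¬ (2 ^ℕ m) · 1# ≈ 0#
    powers-nonzero zero    eq = 1≉0 (trans (sym (+-identityʳ 1#)) eq)
    powers-nonzero (suc m) eq = *-nonzero (λ 2≈0 → 1+1≉0 (trans (+-congˡ (sym (+-identityʳ 1#))) 2≈0))
      (powers-nonzero m) (trans (sym (×1-homo-* 2 (2 ^ℕ m))) eq)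

  open CharacteristicTwo F 1+1≈0 public

  n·1≈1 : n · 1# ≈ 1#
  n·1≈1 = sym (x+y≈0⇒x≈y cardinality≈0)

  x*x^[q-1]≈x^q : ∀ x → x * x ^ q-1 ≈ x ^ q
  x*x^[q-1]≈x^q x = ^-congʳ x 1+[q-1]≡q

  bar-+ : ∀ x y → (x + y) ^ q ≈ x ^ q + y ^ q
  bar-+ = frobenius (suc k)

  bar-* : ∀ x y → (x * y) ^ q ≈ x ^ q * y ^ q
  bar-* x y = ^-distrib-* x y q

  bar-^ : ∀ x m → (x ^ m) ^ q ≈ (x ^ q) ^ m
  bar-^ x m = trans (^-assocʳ x m q) (trans (^-congʳ x (*ℕ-comm m q)) (sym (^-assocʳ x q m)))

  bar-involutive : ∀ x → (x ^ q) ^ q ≈ x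
  bar-involutive x = trans (^-assocʳ x q q) (trans (^-congʳ x q²≡1+n) (x^[1+n]≈x x))

  bar-⁻¹ : ∀ {x} (x≉0 : ¬ x ≈ 0#) → x ^ q ≈ x → (x ⁻¹) x≉0 ^ q ≈ (x ⁻¹) x≉0
  bar-⁻¹ {x} x≉0 x̄≈x = *-cancelˡ x x≉0 (begin
    x * (x ⁻¹) x≉0 ^ q       ≈⟨ *-congʳ x̄≈x ⟨
    x ^ q * (x ⁻¹) x≉0 ^ q   ≈⟨ bar-* _ _ ⟨
    (x * (x ⁻¹) x≉0) ^ q     ≈⟨ ^-congˡ q (⁻¹-inverse x x≉0) ⟩
    1# ^ q                   ≈⟨ 1^ q ⟩
    1#                       ≈⟨ ⁻¹-inverse x x≉0 ⟨
    x * (x ⁻¹) x≉0           ∎)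

  form : Carrier → Carrier → Carrier → Carrier → Carrier
  form a b x x̄ = x ^ 4 + a * x ^ 3 * x̄ + b * x * x̄ ^ 3

  form-cong : ∀ {a b x x̄ y ȳ} → x ≈ y → x̄ ≈ ȳ → form a b x x̄ ≈ form a b y ȳ
  form-cong x≈y x̄≈ȳ =
    +-cong (+-cong (^-congˡ 4 x≈y) (*-cong (*-congˡ (^-congˡ 3 x≈y)) x̄≈ȳ)) (*-cong (*-congˡ x≈y) (^-congˡ 3 x̄≈ȳ))

  fPoly≈ : ∀ a b x → fPoly F q a b x ≈ x ^ 4 * (1# + a * x ^ q-1 + b * (x ^ q-1) ^ 3)
  fPoly≈ a b x = *-congˡ (+-congˡ (*-congˡ (trans (^-congʳ x (*ℕ-comm 3 q-1)) (sym (^-assocʳ x q-1 3)))))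

  fPoly≈form : ∀ a b x → fPoly F q a b x ≈ form a b x (x ^ q)
  fPoly≈form a b x = begin
    fPoly F q a b x                                       ≈⟨ fPoly≈ a b x ⟩
    x ^ 4 * (1# + a * x ^ q-1 + b * (x ^ q-1) ^ 3)        ≈⟨ solve 4 (λ a b x v → x :^ 4 :* (con true :+ a :* v
        :+ b :* v :^ 3) := x :^ 4 :+ a :* x :^ 3 :* (x :* v) :+ b :* x :* (x :* v) :^ 3) refl a b x (x ^ q-1) ⟩
    form a b x (x * x ^ q-1)                              ≈⟨ form-cong refl (x*x^[q-1]≈x^q x) ⟩
    form a b x (x ^ q)                                    ∎

  fPoly-cong : ∀ {a b x y} → x ≈ y → fPoly F q a b x ≈ fPoly F q a b y
  fPoly-cong {a} {b} {x} {y} x≈y =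
    trans (fPoly≈form a b x) (trans (form-cong x≈y (^-congˡ q x≈y)) (sym (fPoly≈form a b y)))

  -- An element of trace 1: any y outside F_q, divided by its nonzero trace y + ȳ, which lies in
  -- F_q.
  ∃-shifted : ∃ λ t → t ^ q ≈ t + 1#
  ∃-shifted with ∃-nonroot-of-unity 0<q-1 q-1<n
  ... | y , y≉0 , y^≉1 = y * d , (begin
    (y * d) ^ q            ≈⟨ bar-* y d ⟩
    y ^ q * d ^ q          ≈⟨ *-congˡ (bar-⁻¹ c≉0 c̄≈c) ⟩
    y ^ q * d              ≈⟨ solve 3 (λ y z d → z :* d := y :* d :+ (y :+ z) :* d) refl y (y ^ q) d ⟩
    y * d + c′ * d         ≈⟨ +-congˡ (⁻¹-inverse c′ c≉0) ⟩
    y * d + 1#             ∎)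
    where
    c′ : Carrier
    c′ = y + y ^ q
    c≉0 : ¬ c′ ≈ 0#
    c≉0 eq = y^≉1 (*-cancelˡ y y≉0 (trans (x*x^[q-1]≈x^q y) (trans (sym (x+y≈0⇒x≈y eq)) (sym (*-identityʳ y)))))
    c̄≈c : c′ ^ q ≈ c′
    c̄≈c = trans (bar-+ _ _) (trans (+-congˡ (bar-involutive y)) (+-comm _ _))
    d : Carrier
    d = (c′ ⁻¹) c≉0

  -- The case a = b

  module EqualCoefficients {a : Carrier} (ā≈a : a ^ q ≈ a) (a≉0 : ¬ a ≈ 0#) where
    private
      a⁻¹ : Carrier
      a⁻¹ = (a ⁻¹) a≉0

    HasRoot : Set _
    HasRoot = ∃ λ x → InSubfield F q x × (x ^ 3 + x + a⁻¹ ≈ 0#)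

    form-on-coset : ∀ x y → form a a x (x + y) ≈ x ^ 4 + a * y ^ 2 * x ^ 2 + a * y ^ 3 * x
    form-on-coset x y = solve 3 (λ a x c → x :^ 4 :+ a :* x :^ 3 :* (x :+ c) :+ a :* x :* (x :+ c) :^ 3 :=
      x :^ 4 :+ a :* c :^ 2 :* x :^ 2 :+ a :* c :^ 3 :* x) refl a x y

    bar-form : ∀ x → form a a x (x ^ q) ^ q ≈ form a a (x ^ q) x
    bar-form x = begin
      form a a x (x ^ q) ^ q
        ≈⟨ trans (bar-+ _ _) (+-congʳ (bar-+ _ _)) ⟩
      (x ^ 4) ^ q + (a * x ^ 3 * x ^ q) ^ q + (a * x * (x ^ q) ^ 3) ^ q
        ≈⟨ +-cong (+-cong (bar-^ x 4) (trans (bar-* _ _) (*-cong (trans (bar-* _ _) (*-cong ā≈a (bar-^ x 3)))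
            (bar-involutive x))))
                  (trans (bar-* _ _) (*-cong (trans (bar-* _ _) (*-congʳ ā≈a)) (trans (bar-^ (x ^ q) 3)
                      (^-congˡ 3 (bar-involutive x))))) ⟩
      form a a (x ^ q) x ∎

    -- The terms with a are symmetric in x and x̄, so adding the conjugate cancels them.
    form-trace : ∀ x → form a a x (x ^ q) + form a a x (x ^ q) ^ q ≈ (x + x ^ q) ^ 4
    form-trace x = trans (+-congˡ (bar-form x))
      (solve 3 (λ a x y → (x :^ 4 :+ a :* x :^ 3 :* y :+ a :* x :* y :^ 3) :+ (y :^ 4 :+ a :* y :^ 3 :* x :+ a
          :* y :* x :^ 3) := (x :+ y) :^ 4) refl a x (x ^ q))

    bar-from-trace : ∀ {x y} → x + x ^ q ≈ y → x ^ q ≈ x + y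
    bar-from-trace {x} {y} eq = trans (solve 2 (λ x z → z := x :+ (x :+ z)) refl x (x ^ q)) (+-congˡ eq)

    private
      same-trace : ∀ {x y} → form a a x (x ^ q) ≈ form a a y (y ^ q) → x + x ^ q ≈ y + y ^ q
      same-trace {x} {y} fx≈fy = frobenius-injective 2
        (trans (sym (form-trace x)) (trans (+-cong fx≈fy (^-congˡ q fx≈fy)) (form-trace y)))

      on-subfield : ∀ {z} → z + z ^ q ≈ 0# → form a a z (z ^ q) ≈ z ^ 4
      on-subfield {z} eq = trans (form-cong refl (bar-from-trace eq)) (trans (form-on-coset z 0#)
        (solve 2 (λ a z → z :^ 4 :+ a :* con false :^ 2 :* z :^ 2 :+ a :* con false :^ 3 :* z := z :^ 4) refl a z))

    module _ {x y : Carrier} (fx≈fy : form a a x (x ^ q) ≈ form a a y (y ^ q)) where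
      private
        c′ e : Carrier
        c′ = x + x ^ q
        e = x + y

        x̄≈x+c : x ^ q ≈ x + c′
        x̄≈x+c = bar-from-trace refl

        ȳ≈y+c : y ^ q ≈ y + c′
        ȳ≈y+c = bar-from-trace (sym (same-trace fx≈fy))

        c̄≈c : c′ ^ q ≈ c′
        c̄≈c = trans (bar-+ _ _) (trans (+-congˡ (bar-involutive x)) (+-comm _ _))

        ē≈e : e ^ q ≈ e
        ē≈e = begin
          e ^ q               ≈⟨ bar-+ x y ⟩
          x ^ q + y ^ q       ≈⟨ +-cong x̄≈x+c ȳ≈y+c ⟩
          x + c′ + (y + c′)   ≈⟨ solve 3 (λ x y c → x :+ c :+ (y :+ c) := x :+ y) refl x y c′ ⟩
          e                   ∎

      collision : e * (e ^ 3 + a * c′ ^ 2 * e + a * c′ ^ 3) ≈ 0#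
      collision = begin
        e * (e ^ 3 + a * c′ ^ 2 * e + a * c′ ^ 3)
          ≈⟨ solve 4 (λ a x y c → (x :+ y) :* ((x :+ y) :^ 3 :+ a :* c :^ 2 :* (x :+ y) :+ a :* c :^ 3) :=
               (x :^ 4 :+ a :* c :^ 2 :* x :^ 2 :+ a :* c :^ 3 :* x) :+ (y :^ 4 :+ a :* c :^ 2 :* y :^ 2 :+ a
                   :* c :^ 3 :* y)) refl a x y c′ ⟩
        x ^ 4 + a * c′ ^ 2 * x ^ 2 + a * c′ ^ 3 * x + (y ^ 4 + a * c′ ^ 2 * y ^ 2 + a * c′ ^ 3 * y)
          ≈⟨ +-cong (form-on-coset x c′) (form-on-coset y c′) ⟨
        form a a x (x + c′) + form a a y (y + c′)
          ≈⟨ +-cong (form-cong refl x̄≈x+c) (form-cong refl ȳ≈y+c) ⟨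
        form a a x (x ^ q) + form a a y (y ^ q)
          ≈⟨ x≈y⇒x+y≈0 fx≈fy ⟩
        0# ∎

      collision⇒root : ¬ e ≈ 0# → e ^ 3 + a * c′ ^ 2 * e + a * c′ ^ 3 ≈ 0# → HasRoot
      collision⇒root e≉0 eq = c′ * i + 1# , bar-z , cancel-factor (*-nonzero a≉0 (^-nonzero 3 e≉0)) (begin
        a * e ^ 3 * ((c′ * i + 1#) ^ 3 + (c′ * i + 1#) + a⁻¹)
          ≈⟨ solve 5 (λ a c e i j → a :* e :^ 3 :* ((c :* i :+ con true) :^ 3 :+ (c :* i :+ con true) :+ j) :=
               (a :* j) :* e :^ 3 :+ a :* c :^ 2 :* e :* (e :* i) :^ 2 :+ a :* c :^ 3 :* (e :* i) :^ 3) refl a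
                   c′ e i a⁻¹ ⟩
        a * a⁻¹ * e ^ 3 + a * c′ ^ 2 * e * (e * i) ^ 2 + a * c′ ^ 3 * (e * i) ^ 3
          ≈⟨ +-cong (+-cong (*-congʳ (⁻¹-inverse a a≉0)) (*-congˡ (^-congˡ 2 ei≈1))) (*-congˡ (^-congˡ 3 ei≈1)) ⟩
        1# * e ^ 3 + a * c′ ^ 2 * e * 1# ^ 2 + a * c′ ^ 3 * 1# ^ 3
          ≈⟨ solve 3 (λ a c e → con true :* e :^ 3 :+ a :* c :^ 2 :* e :* con true :^ 2 :+ a :* c :^ 3 :* con
              true :^ 3 :=
               e :^ 3 :+ a :* c :^ 2 :* e :+ a :* c :^ 3) refl a c′ e ⟩
        e ^ 3 + a * c′ ^ 2 * e + a * c′ ^ 3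
          ≈⟨ eq ⟩
        0# ∎)
        where
        i : Carrier
        i = (e ⁻¹) e≉0
        ei≈1 : e * i ≈ 1#
        ei≈1 = ⁻¹-inverse e e≉0
        bar-z : (c′ * i + 1#) ^ q ≈ c′ * i + 1#
        bar-z = trans (bar-+ _ _) (+-cong (trans (bar-* _ _) (*-cong c̄≈c (bar-⁻¹ e≉0 ē≈e))) (1^ q))

    injective : ¬ HasRoot → ∀ x y → form a a x (x ^ q) ≈ form a a y (y ^ q) → x ≈ y
    injective ∄root x y fx≈fy with (x + x ^ q) ≟ 0# | (x + y) ≟ 0#
    ... | _        | yes e≈0 = x+y≈0⇒x≈y e≈0
    -- At trace 0 both points lie in F_q, where the form is x⁴ and hence injective.
    ... | yes tr≈0 | no _ = frobenius-injective 2
      (trans (sym (on-subfield tr≈0)) (trans fx≈fy (on-subfield (trans (sym (same-trace fx≈fy)) tr≈0))))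
    ... | no  _    | no e≉0 = ⊥-elim (∄root (collision⇒root fx≈fy e≉0 (cancel-factor e≉0 (collision fx≈fy))))

    -- The case c = 1 suffices: solving z = 1/d + 1 for the difference gives d = 1/(z + 1), and
    -- `∃-shifted` supplies a point t with x̄ = x + 1.
    root⇒collision : HasRoot → ∃ λ x → ∃ λ y → form a a x (x ^ q) ≈ form a a y (y ^ q) × ¬ x ≈ y
    root⇒collision (z , z̄≈z , root) = t , t + d , same , λ t≈t+d → d≉0
      (trans (solve 2 (λ t d → d := t :+ (t :+ d)) refl t d) (x≈y⇒x+y≈0 t≈t+d))
      where
      t u : Carrier
      t = proj₁ ∃-shifted
      u = z + 1#
      t̄≈t+1 : t ^ q ≈ t + 1#
      t̄≈t+1 = proj₂ ∃-shifted
      -- At z = 1 the cubic takes the value a⁻¹ ≠ 0.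
      u≉0 : ¬ u ≈ 0#
      u≉0 u≈0 = ⁻¹-nonzero a a≉0 (trans
        (solve 2 (λ z j → j := (z :^ 3 :+ z :+ j) :+ (z :* (z :+ con true)) :* (z :+ con true)) refl z a⁻¹)
        (root ⊹ (z * u) ⊛ u≈0))
      d : Carrier
      d = (u ⁻¹) u≉0
      d≉0 : ¬ d ≈ 0#
      d≉0 = ⁻¹-nonzero u u≉0
      d̄≈d : d ^ q ≈ d
      d̄≈d = bar-⁻¹ u≉0 (trans (bar-+ z 1#) (+-cong z̄≈z (1^ q)))
      bar-t+d : (t + d) ^ q ≈ (t + d) + 1#
      bar-t+d = trans (bar-+ t d) (trans (+-cong t̄≈t+1 d̄≈d)
        (solve 2 (λ t d → t :+ con true :+ d := t :+ d :+ con true) refl t d))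
      d³+ad+a≈0 : d ^ 3 + a * d + a ≈ 0#
      d³+ad+a≈0 = cancel-factor (^-nonzero 3 u≉0) (begin
        u ^ 3 * (d ^ 3 + a * d + a)
          ≈⟨ solve 3 (λ a u d → u :^ 3 :* (d :^ 3 :+ a :* d :+ a) := (u :* d) :^ 3 :+ a :* u :^ 2 :* (u :* d)
              :+ a :* u :^ 3) refl a u d ⟩
        (u * d) ^ 3 + a * u ^ 2 * (u * d) + a * u ^ 3
          ≈⟨ +-congʳ (+-cong (^-congˡ 3 (⁻¹-inverse u u≉0)) (*-congˡ (⁻¹-inverse u u≉0))) ⟩
        1# ^ 3 + a * u ^ 2 * 1# + a * u ^ 3
          ≈⟨ solve 2 (λ a z → con true :^ 3 :+ a :* (z :+ con true) :^ 2 :* con true :+ a :* (z :+ con true) :^ 3 :=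
               con true :+ a :* (z :^ 3 :+ z)) refl a z ⟩
        1# + a * (z ^ 3 + z)
          ≈⟨ +-congʳ (⁻¹-inverse a a≉0) ⟨
        a * a⁻¹ + a * (z ^ 3 + z)
          ≈⟨ solve 3 (λ a j z → a :* j :+ a :* (z :^ 3 :+ z) := a :* (z :^ 3 :+ z :+ j)) refl a a⁻¹ z ⟩
        a * (z ^ 3 + z + a⁻¹)
          ≈⟨ a ⊛ root ⟩
        0# ∎)
      same : form a a t (t ^ q) ≈ form a a (t + d) ((t + d) ^ q)
      same = x+y≈0⇒x≈y (begin
        form a a t (t ^ q) + form a a (t + d) ((t + d) ^ q)
          ≈⟨ +-cong (form-cong refl t̄≈t+1) (form-cong refl bar-t+d) ⟩
        form a a t (t + 1#) + form a a (t + d) (t + d + 1#)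
          ≈⟨ solve 3 (λ a t d → (t :^ 4 :+ a :* t :^ 3 :* (t :+ con true) :+ a :* t :* (t :+ con true) :^ 3)
               :+ ((t :+ d) :^ 4 :+ a :* (t :+ d) :^ 3 :* (t :+ d :+ con true) :+ a :* (t :+ d) :* (t :+ d :+
                   con true) :^ 3)
               := d :* (d :^ 3 :+ a :* d :+ a)) refl a t d ⟩
        d * (d ^ 3 + a * d + a)
          ≈⟨ d ⊛ d³+ad+a≈0 ⟩
        0# ∎)

-- Binary digits

-- Built from constructors, unlike `2 *ℕ m`, so that `entry` computes on doubled indices.
double : ℕ → ℕ
double zero    = zero
double (suc m) = suc (suc (double m))

double≡2* : ∀ m → double m ≡ 2 *ℕ m
double≡2* zero    = ≡.refl
double≡2* (suc m) = ≡.trans (≡.cong (2 +ℕ_) (double≡2* m)) (≡.cong suc (≡.sym (+ℕ-suc m (m +ℕ 0))))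

double-mono : ∀ {m o} → m ≤ o → double m ≤ double o
double-mono z≤n     = z≤n
double-mono (s≤s p) = s≤s (s≤s (double-mono p))

doubles : ℕ → ℕ → ℕ
doubles m zero    = m
doubles m (suc j) = double (doubles m j)

doubles≡*2^ : ∀ m j → doubles m j ≡ m *ℕ 2 ^ℕ j
doubles≡*2^ m zero    = ≡.sym (≡.trans (*ℕ-comm m 1) (+ℕ-comm m 0))
doubles≡*2^ m (suc j) = ≡.trans (double≡2* (doubles m j)) (≡.trans (≡.cong (2 *ℕ_) (doubles≡*2^ m j))
  (+-*-Solver.solve 2 (λ m x → +-*-Solver.con 2 :*: (m :*: x) :=: m :*: (+-*-Solver.con 2 :*: x)) ≡.refl m (2 ^ℕ j)))
  where open +-*-Solver using () renaming (_:*_ to _:*:_; _:=_ to _:=:_)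

-- This is 2^m - 1, kept as the sum of the digit weights that occur in `product`.
mersenne : ℕ → ℕ
mersenne zero    = 0
mersenne (suc m) = mersenne m +ℕ 2 ^ℕ m

1+mersenne≡2^ : ∀ m → suc (mersenne m) ≡ 2 ^ℕ m
1+mersenne≡2^ zero    = ≡.refl
1+mersenne≡2^ (suc m) = ≡.trans (≡.cong (_+ℕ 2 ^ℕ m) (1+mersenne≡2^ m)) (≡.cong (2 ^ℕ m +ℕ_) (≡.sym (+ℕ-comm (2
    ^ℕ m) 0)))

-- Power sums over the roots of unity of order q + 1

module PowerSums {c ℓ} (F : Field c ℓ) (k : ℕ) (hasCardinality : HasCardinality F (2 ^ℕ suc k *ℕ 2 ^ℕ suc k)) where
  open Field F hiding (zero)
  open QuadraticExtension F k hasCardinality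
  open SetoidReasoning setoid
  open Exp semiring using (^-congˡ; ^-congʳ; ^-homo-*; ^-assocʳ)
  open CommExp commutativeSemiring using (^-distrib-*)

  -- As x runs through the nonzero elements, x^(q-1) runs q - 1 times through the
  -- (q + 1)-st roots of unity, so these are power sums over the latter.
  powerSum : ℕ → Carrier
  powerSum e = ∑ (λ x → (x ^ q-1) ^ e)

  powerSum-cong : ∀ {d e} → d ≡ e → powerSum d ≈ powerSum e
  powerSum-cong d≡e = reflexive (≡.cong powerSum d≡e)

  norm-one : ∀ {x} → ¬ x ≈ 0# → (x ^ q-1) ^ suc q ≈ 1#
  norm-one x≉0 = trans (^-assocʳ _ q-1 (suc q)) (x^n≈1 x≉0)

  -- Since (q - 1) r < q² - 1, some y has y^((q-1)r) ≠ 1, and the multiple of q + 1 in the exponent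
  -- does not change this power.
  powerSum-zero : ∀ r d → 0 < r → r ≤ q → powerSum (r +ℕ d *ℕ suc q) ≈ 0#
  powerSum-zero r d 0<r r≤q with ∃-nonroot-of-unity {q-1 *ℕ r} (*-mono-≤ 0<q-1 0<r) (*-monoʳ-< q-1 {{>-nonZero
      0<q-1}} (s≤s r≤q))
  ... | y , y≉0 , y^≉1 = trans (∑-cong (λ x → ^-assocʳ x q-1 e)) (∑-^-zero (q-1 *ℕ e) y≉0 λ eq → y^≉1 (begin
    y ^ (q-1 *ℕ r)                                 ≈⟨ ^-assocʳ y q-1 r ⟨
    (y ^ q-1) ^ r                                  ≈⟨ *-identityʳ _ ⟨
    (y ^ q-1) ^ r * 1#                             ≈⟨ *-congˡ (1^ d) ⟨
    (y ^ q-1) ^ r * 1# ^ d                         ≈⟨ *-congˡ (^-congˡ d (norm-one y≉0)) ⟨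
    (y ^ q-1) ^ r * ((y ^ q-1) ^ suc q) ^ d        ≈⟨ *-congˡ (^-assocʳ _ (suc q) d) ⟩
    (y ^ q-1) ^ r * (y ^ q-1) ^ (suc q *ℕ d)       ≈⟨ *-congˡ (^-congʳ _ (*ℕ-comm (suc q) d)) ⟩
    (y ^ q-1) ^ r * (y ^ q-1) ^ (d *ℕ suc q)       ≈⟨ ^-homo-* _ r (d *ℕ suc q) ⟨
    (y ^ q-1) ^ e                                  ≈⟨ ^-assocʳ y q-1 e ⟩
    y ^ (q-1 *ℕ e)                                 ≈⟨ eq ⟩
    1#                                             ∎))
    where
    e : ℕ
    e = r +ℕ d *ℕ suc q

  -- A positive exponent makes the term at 0 vanish; the other n terms are 1, and n is odd.
  powerSum-one : ∀ d → powerSum (suc d *ℕ suc q) ≈ 1#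
  powerSum-one d = trans (∑-nonzero-constant at-zero (λ x≈y → ^-congˡ (suc d *ℕ suc q) (^-congˡ q-1 x≈y)) away) n·1≈1
    where
    at-zero : (0# ^ q-1) ^ (suc d *ℕ suc q) ≈ 0#
    at-zero = trans (*-congʳ (0^ 0<q-1)) (zeroˡ _)
    away : ∀ x → ¬ x ≈ 0# → (x ^ q-1) ^ (suc d *ℕ suc q) ≈ 1#
    away x x≉0 = trans (^-congʳ _ (*ℕ-comm (suc d) (suc q))) (trans (sym (^-assocʳ _ (suc q) (suc d)))
      (trans (^-congˡ (suc d) (norm-one x≉0)) (1^ (suc d))))

  record Triple : Set c where
    constructor ⟨_,_,_⟩
    field
      fst₃ snd₃ thd₃ : Carrier
  open Triple public

  -- u holds the coefficients belonging to the carries x - y = 1, 2, 3; no other carry contributes.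
  entry : Triple → ℕ → ℕ → Carrier
  entry u zero                   y       = 0#
  entry u (suc x)                (suc y) = entry u x y
  entry u 1                      zero    = fst₃ u
  entry u 2                      zero    = snd₃ u
  entry u 3                      zero    = thd₃ u
  entry u (suc (suc (suc (suc x)))) zero = 0#

  entry-hit : ∀ u i y → entry u (y +ℕ i) y ≈ entry u i 0
  entry-hit u i zero    = refl
  entry-hit u i (suc y) = entry-hit u i y

  entry-miss : ∀ u i → (∀ x → ¬ x ≡ i → entry u x 0 ≈ 0#) → ∀ x y → ¬ x ≡ y +ℕ i → entry u x y ≈ 0#
  entry-miss u i miss x       zero    x≢ = miss x x≢
  entry-miss u i miss zero    (suc y) x≢ = refl
  entry-miss u i miss (suc x) (suc y) x≢ = entry-miss u i miss x y (x≢ ∘ ≡.cong suc)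

  e₁ e₂ e₃ : Triple
  e₁ = ⟨ 1# , 0# , 0# ⟩
  e₂ = ⟨ 0# , 1# , 0# ⟩
  e₃ = ⟨ 0# , 0# , 1# ⟩

  e₁-miss : ∀ x → ¬ x ≡ 1 → entry e₁ x 0 ≈ 0#
  e₁-miss 0 _ = refl
  e₁-miss 1 x≢1 = ⊥-elim (x≢1 ≡.refl)
  e₁-miss 2 _ = refl
  e₁-miss 3 _ = refl
  e₁-miss (suc (suc (suc (suc x)))) _ = refl

  e₂-miss : ∀ x → ¬ x ≡ 2 → entry e₂ x 0 ≈ 0#
  e₂-miss 0 _ = refl
  e₂-miss 1 _ = refl
  e₂-miss 2 x≢2 = ⊥-elim (x≢2 ≡.refl)
  e₂-miss 3 _ = refl
  e₂-miss (suc (suc (suc (suc x)))) _ = refl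

  e₃-miss : ∀ x → ¬ x ≡ 3 → entry e₃ x 0 ≈ 0#
  e₃-miss 0 _ = refl
  e₃-miss 1 _ = refl
  e₃-miss 2 _ = refl
  e₃-miss 3 x≢3 = ⊥-elim (x≢3 ≡.refl)
  e₃-miss (suc (suc (suc (suc x)))) _ = refl

  private
    -- As m(q + 1) = mq + m, the exponent 4 + y meets this target exactly when the carry mq - y left
    -- at the lowest digit is 4 - m. Hence the targets 1, 2, 3 go with e₃, e₂, e₁.
    e-split : ∀ m i y → m +ℕ i ≡ 4 → (m *ℕ q ≡ y +ℕ i → 4 +ℕ y ≡ m *ℕ suc q)
    e-split m i y m+i≡4 eq = ≡.trans (≡.cong (_+ℕ y) (≡.sym m+i≡4)) (≡.trans (+ℕ-assoc m i y)
      (≡.trans (≡.cong (m +ℕ_) (≡.trans (+ℕ-comm i y) (≡.sym eq))) (≡.sym (*-suc m q))))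

    e-join : ∀ m i y → m +ℕ i ≡ 4 → 4 +ℕ y ≡ m *ℕ suc q → m *ℕ q ≡ y +ℕ i
    e-join m i y m+i≡4 eq = +-cancelˡ-≡ m _ _ (≡.trans (≡.sym (*-suc m q)) (≡.trans (≡.sym eq)
      (≡.trans (≡.cong (_+ℕ y) (≡.sym m+i≡4)) (≡.trans (+ℕ-assoc m i y) (≡.cong (m +ℕ_) (+ℕ-comm i y))))))

  entries : ℕ → Carrier
  entries y = entry e₃ (1 *ℕ q) y + entry e₂ (2 *ℕ q) y + entry e₁ (3 *ℕ q) y

  powerSum≈entries : ∀ y → 4 +ℕ y ≤ 4 *ℕ q → powerSum (4 +ℕ y) ≈ entries y
  powerSum≈entries y bound = by-remainder ((4 +ℕ y) % suc q) ((4 +ℕ y) / suc q) (m≡m%n+[m/n]*n (4 +ℕ y) (suc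
      q)) (m%n<n (4 +ℕ y) (suc q))
    where
    miss₁ : ¬ 4 +ℕ y ≡ 1 *ℕ suc q → entry e₃ (1 *ℕ q) y ≈ 0#
    miss₁ ≢ = entry-miss e₃ 3 e₃-miss _ y (≢ ∘ e-split 1 3 y ≡.refl)
    miss₂ : ¬ 4 +ℕ y ≡ 2 *ℕ suc q → entry e₂ (2 *ℕ q) y ≈ 0#
    miss₂ ≢ = entry-miss e₂ 2 e₂-miss _ y (≢ ∘ e-split 2 2 y ≡.refl)
    miss₃ : ¬ 4 +ℕ y ≡ 3 *ℕ suc q → entry e₁ (3 *ℕ q) y ≈ 0#
    miss₃ ≢ = entry-miss e₁ 1 e₁-miss _ y (≢ ∘ e-split 3 1 y ≡.refl)
    hit : ∀ m i u → m +ℕ i ≡ 4 → 4 +ℕ y ≡ m *ℕ suc q → entry u (m *ℕ q) y ≈ entry u i 0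
    hit m i u m+i≡4 eq = trans (reflexive (≡.cong (λ x → entry u x y) (e-join m i y m+i≡4 eq))) (entry-hit u i y)
    distinct : ∀ {d} m → ¬ d ≡ m → 4 +ℕ y ≡ d *ℕ suc q → ¬ 4 +ℕ y ≡ m *ℕ suc q
    distinct m d≢m eq eq′ = d≢m (*-cancelʳ-≡ _ m (suc q) (≡.trans (≡.sym eq) eq′))
    by-remainder : ∀ r d → 4 +ℕ y ≡ r +ℕ d *ℕ suc q → r < suc q → powerSum (4 +ℕ y) ≈ entries y
    by-remainder (suc r) d eq (s≤s r<q) = trans (trans (powerSum-cong eq) (powerSum-zero (suc r) d (s≤s z≤n) r<q))
      (sym ((miss₁ (indivisible 1) ⊹ miss₂ (indivisible 2)) ⊹ miss₃ (indivisible 3)))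
      where
      indivisible : ∀ m → ¬ 4 +ℕ y ≡ m *ℕ suc q
      indivisible m eq′ with ≡.trans (≡.sym (≡.trans ([m+kn]%n≡m%n (suc r) d (suc q)) (m<n⇒m%n≡m (s≤s r<q))))
        (≡.trans (≡.cong (_% suc q) (≡.trans (≡.sym eq) eq′)) (m*n%n≡0 m (suc q)))
      ... | ()
    by-remainder zero zero () _
    by-remainder zero 1 eq _ = trans (trans (powerSum-cong eq) (powerSum-one 0))
      (sym (trans (+-cong (+-cong (hit 1 3 e₃ ≡.refl eq) (miss₂ (distinct {1} 2 (λ ()) eq))) (miss₃ (distinct
          {1} 3 (λ ()) eq)))
        (trans (+-identityʳ _) (+-identityʳ _))))
    by-remainder zero 2 eq _ = trans (trans (powerSum-cong eq) (powerSum-one 1))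
      (sym (trans (+-cong (+-cong (miss₁ (distinct {2} 1 (λ ()) eq)) (hit 2 2 e₂ ≡.refl eq)) (miss₃ (distinct
          {2} 3 (λ ()) eq)))
        (trans (+-identityʳ _) (+-identityˡ _))))
    by-remainder zero 3 eq _ = trans (trans (powerSum-cong eq) (powerSum-one 2))
      (sym (trans (+-cong (miss₁ (distinct {3} 1 (λ ()) eq) ⊹ miss₂ (distinct {3} 2 (λ ()) eq)) (hit 3 1 e₁
          ≡.refl eq)) (+-identityˡ _)))
    -- The next multiple, 4(q + 1), already exceeds the bound 4q.
    by-remainder zero (suc (suc (suc (suc d)))) eq _ = ⊥-elim (1+n≰n (≤-trans (≤-trans (s≤s (m≤n+m (4 *ℕ q) 3))
      (≤-trans (≤-reflexive (≡.sym (*-suc 4 q))) (*-monoˡ-≤ (suc q) (m≤m+n 4 d)))) (≤-trans (≤-reflexive (≡.sym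
          eq)) bound)))

  Letter : Set c
  Letter = Carrier × Carrier

  -- The head of the vector is the highest binary digit, so a word is read from its end.
  product : (Letter → Carrier) → ∀ {m} → Vec Letter m → Carrier
  product φ []              = 1#
  product φ {suc m} (l ∷ w) = product φ w * φ l ^ (2 ^ℕ m)

  linear : Carrier → Letter → Carrier
  linear v (α , β) = α + β * v

  linear-cong : ∀ {u v} → u ≈ v → ∀ l → linear u l ≈ linear v l
  linear-cong u≈v (α , β) = +-congˡ (*-congˡ u≈v)

  product-cong : ∀ {φ ψ} → (∀ l → φ l ≈ ψ l) → ∀ {m} (w : Vec Letter m) → product φ w ≈ product ψ w
  product-cong φ≈ψ []              = refl
  product-cong φ≈ψ {suc m} (l ∷ w) = *-cong (product-cong φ≈ψ w) (^-congˡ (2 ^ℕ m) (φ≈ψ l))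

  product-scale : ∀ D {φ ψ} → (∀ l → φ l ≈ D * ψ l) → ∀ {m} (w : Vec Letter m) →
                  product φ w ≈ D ^ mersenne m * product ψ w
  product-scale D φ≈Dψ [] = sym (*-identityˡ 1#)
  product-scale D {φ} {ψ} φ≈Dψ {suc m} (l ∷ w) = begin
    product φ w * φ l ^ (2 ^ℕ m)
      ≈⟨ *-cong (product-scale D φ≈Dψ w) (trans (^-congˡ (2 ^ℕ m) (φ≈Dψ l)) (^-distrib-* D (ψ l) (2 ^ℕ m))) ⟩
    D ^ mersenne m * product ψ w * (D ^ (2 ^ℕ m) * ψ l ^ (2 ^ℕ m))
      ≈⟨ solve 4 (λ x y z u → x :* y :* (z :* u) := x :* z :* (y :* u)) refl _ _ _ _ ⟩
    D ^ mersenne m * D ^ (2 ^ℕ m) * (product ψ w * ψ l ^ (2 ^ℕ m))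
      ≈⟨ *-congʳ (^-homo-* D (mersenne m) (2 ^ℕ m)) ⟨
    D ^ mersenne (suc m) * product ψ (l ∷ w) ∎

  -- All exponents in the expansion lie between e and e + 2^m - 1, hence between 1 and q, where no
  -- multiple of q + 1 occurs.
  linear-sum : ∀ {m} (w : Vec Letter m) e → 0 < e → e +ℕ mersenne m ≤ q →
               ∑ (λ x → (x ^ q-1) ^ e * product (linear (x ^ q-1)) w) ≈ 0#
  linear-sum [] e 0<e e≤q = trans (∑-cong (λ x → trans (*-identityʳ _) (^-congʳ _ (≡.sym (+ℕ-comm e 0)))))
    (powerSum-zero e 0 0<e (≤-trans (m≤m+n e 0) e≤q))
  linear-sum {suc m} ((α , β) ∷ w) e 0<e e≤q = begin
    ∑ (λ x → (x ^ q-1) ^ e * (P x * (α + β * x ^ q-1) ^ Q))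
      ≈⟨ ∑-cong expand ⟩
    ∑ (λ x → α ^ Q * ((x ^ q-1) ^ e * P x) + β ^ Q * ((x ^ q-1) ^ (e +ℕ Q) * P x))
      ≈⟨ trans (∑-+ _ _) (+-cong (∑-* (α ^ Q) _) (∑-* (β ^ Q) _)) ⟩
    α ^ Q * ∑ (λ x → (x ^ q-1) ^ e * P x) + β ^ Q * ∑ (λ x → (x ^ q-1) ^ (e +ℕ Q) * P x)
      ≈⟨ α ^ Q ⊛ linear-sum w e 0<e (≤-trans (+-monoʳ-≤ e (m≤m+n (mersenne m) Q)) e≤q)
         ⊹ β ^ Q ⊛ linear-sum w (e +ℕ Q) (≤-trans 0<e (m≤m+n e Q)) (≤-trans (≤-reflexive bound) e≤q) ⟩
    0# ∎
    where
    Q : ℕ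
    Q = 2 ^ℕ m
    P : Carrier → Carrier
    P x = product (linear (x ^ q-1)) w
    bound : e +ℕ Q +ℕ mersenne m ≡ e +ℕ (mersenne m +ℕ Q)
    bound = ≡.trans (+ℕ-assoc e Q (mersenne m)) (≡.cong (e +ℕ_) (+ℕ-comm Q (mersenne m)))
    expand : ∀ x → (x ^ q-1) ^ e * (P x * (α + β * x ^ q-1) ^ Q) ≈
                   α ^ Q * ((x ^ q-1) ^ e * P x) + β ^ Q * ((x ^ q-1) ^ (e +ℕ Q) * P x)
    expand x = begin
      (x ^ q-1) ^ e * (P x * (α + β * x ^ q-1) ^ Q)
        ≈⟨ *-congˡ (*-congˡ (trans (frobenius m α _) (+-congˡ (^-distrib-* β _ Q)))) ⟩
      (x ^ q-1) ^ e * (P x * (α ^ Q + β ^ Q * (x ^ q-1) ^ Q))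
        ≈⟨ solve 5 (λ v p α β u → v :* (p :* (α :+ β :* u)) := α :* (v :* p) :+ β :* (v :* u :* p)) refl _ _ _ _ _ ⟩
      α ^ Q * ((x ^ q-1) ^ e * P x) + β ^ Q * ((x ^ q-1) ^ e * (x ^ q-1) ^ Q * P x)
        ≈⟨ +-congˡ (*-congˡ (*-congʳ (^-homo-* _ e Q))) ⟨
      α ^ Q * ((x ^ q-1) ^ e * P x) + β ^ Q * ((x ^ q-1) ^ (e +ℕ Q) * P x) ∎

  -- The carry automaton and Hermite's criterion

  module Automaton (a b : Carrier) where
    b̄ : Carrier
    b̄ = b ^ q

    -- On v of norm one conjugation inverts v, and for a in F_q `N v` is v⁴ times the conjugate of
    -- `D v`.
    D N : Carrier → Carrier
    D v = 1# + a * v + b * v ^ 3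
    N v = v ^ 4 + a * v ^ 3 + b̄ * v

    pencil : Carrier → Letter → Carrier
    pencil v (α , β) = α * D v + β * N v

    coeff₀ coeff₁ coeff₃ coeff₄ : Letter → Carrier
    coeff₀ (α , β) = α
    coeff₁ (α , β) = a * α + b̄ * β
    coeff₃ (α , β) = b * α + a * β
    coeff₄ (α , β) = β

    combine : ℕ → Letter → (ℕ → Carrier) → Carrier
    combine m l g = coeff₀ l ^ (2 ^ℕ m) * g 0 + coeff₁ l ^ (2 ^ℕ m) * g 1 + coeff₃ l ^ (2 ^ℕ m) * g 3 + coeff₄
        l ^ (2 ^ℕ m) * g 4

    combine-cong : ∀ m l {g h} → (∀ i → g i ≈ h i) → combine m l g ≈ combine m l h
    combine-cong m l g≈h = +-cong (+-cong (+-cong (*-congˡ (g≈h 0)) (*-congˡ (g≈h 1))) (*-congˡ (g≈h 3)))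
        (*-congˡ (g≈h 4))

    combine-+ : ∀ m l g h → combine m l g + combine m l h ≈ combine m l (λ i → g i + h i)
    combine-+ m l g h = solve 12 (λ m₀ m₁ m₃ m₄ g₀ g₁ g₃ g₄ h₀ h₁ h₃ h₄ →
        (m₀ :* g₀ :+ m₁ :* g₁ :+ m₃ :* g₃ :+ m₄ :* g₄) :+ (m₀ :* h₀ :+ m₁ :* h₁ :+ m₃ :* h₃ :+ m₄ :* h₄) :=
        m₀ :* (g₀ :+ h₀) :+ m₁ :* (g₁ :+ h₁) :+ m₃ :* (g₃ :+ h₃) :+ m₄ :* (g₄ :+ h₄)) refl
      (coeff₀ l ^ (2 ^ℕ m)) (coeff₁ l ^ (2 ^ℕ m)) (coeff₃ l ^ (2 ^ℕ m)) (coeff₄ l ^ (2 ^ℕ m))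
      (g 0) (g 1) (g 3) (g 4) (h 0) (h 1) (h 3) (h 4)

    -- A digit that contributes the exponent i ∈ {0, 1, 3, 4} turns carry d into 2d - i. From d ≤ 0
    -- all later carries stay ≤ 0, and from d ≥ 4 they stay ≥ 4, so 1, 2, 3 suffice. Row d collects
    -- the two i with 2d - i among them.
    step : ℕ → Letter → Triple → Triple
    step m l ⟨ x , y , z ⟩ =
      ⟨ coeff₁ l ^ (2 ^ℕ m) * x + coeff₀ l ^ (2 ^ℕ m) * y
      , coeff₃ l ^ (2 ^ℕ m) * x + coeff₁ l ^ (2 ^ℕ m) * z
      , coeff₄ l ^ (2 ^ℕ m) * y + coeff₃ l ^ (2 ^ℕ m) * z ⟩

    run : ∀ {m} → Vec Letter m → Triple → Triple
    run []              u = u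
    run {suc m} (l ∷ w) u = step m l (run w u)

    entry-step : ∀ m l u x y → entry (step m l u) x y ≈ combine m l (λ i → entry u (double x) (i +ℕ double y))
    entry-step m l u zero    y       = solve 4 (λ s t v w → con false := s :* con false :+ t :* con false :+ v
        :* con false :+ w :* con false) refl _ _ _ _
    entry-step m l u (suc x) (suc y) = entry-step m l u x y
    entry-step m l u 1       zero    = solve 6 (λ s t v w x y → t :* x :+ s :* y := s :* y :+ t :* x :+ v :*
        con false :+ w :* con false) refl _ _ (coeff₃ l ^ (2 ^ℕ m)) (coeff₄ l ^ (2 ^ℕ m)) _ _
    entry-step m l u 2       zero    = solve 6 (λ s t v w x z → v :* x :+ t :* z := s :* con false :+ t :* z :+
        v :* x :+ w :* con false) refl (coeff₀ l ^ (2 ^ℕ m)) _ _ (coeff₄ l ^ (2 ^ℕ m)) _ _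
    entry-step m l u 3       zero    = solve 6 (λ s t v w y z → w :* y :+ v :* z := s :* con false :+ t :* con
        false :+ v :* z :+ w :* y) refl (coeff₀ l ^ (2 ^ℕ m)) (coeff₁ l ^ (2 ^ℕ m)) _ _ _ _
    entry-step m l u (suc (suc (suc (suc x)))) zero = solve 4 (λ s t v w → con false := s :* con false :+ t :*
        con false :+ v :* con false :+ w :* con false) refl _ _ _ _

    -- The exponents that occur lie between 4 and 4q, and among them only q + 1, 2(q + 1) and
    -- 3(q + 1) have a nonzero power sum: hence one run for each of these three targets.
    total : ∀ {m} → Vec Letter m → ℕ → ℕ → Carrier
    total w j y = entry (run w e₃) (doubles 1 j) y + entry (run w e₂) (doubles 2 j) y + entry (run w e₁)
        (doubles 3 j) y

    total-step : ∀ {m} l (w : Vec Letter m) j y → total (l ∷ w) j y ≈ combine m l (λ i → total w (suc j) (i +ℕ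
        double y))
    total-step {m} l w j y = begin
      total (l ∷ w) j y
        ≈⟨ +-cong (+-cong (entry-step m l (run w e₃) (doubles 1 j) y) (entry-step m l (run w e₂) (doubles 2 j)
            y)) (entry-step m l (run w e₁) (doubles 3 j) y) ⟩
      combine m l g₁ + combine m l g₂ + combine m l g₃
        ≈⟨ trans (+-congʳ (combine-+ m l g₁ g₂)) (combine-+ m l (λ i → g₁ i + g₂ i) g₃) ⟩
      combine m l (λ i → total w (suc j) (i +ℕ double y)) ∎
      where
      g₁ g₂ g₃ : ℕ → Carrier
      g₁ i = entry (run w e₃) (doubles 1 (suc j)) (i +ℕ double y)
      g₂ i = entry (run w e₂) (doubles 2 (suc j)) (i +ℕ double y)
      g₃ i = entry (run w e₁) (doubles 3 (suc j)) (i +ℕ double y)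

    -- The offset y records what the higher digits, already expanded, contribute in units of 2^m;
    -- the 4 is the factor v⁴ of f^(q-1).
    wordSum : ∀ {m} → Vec Letter m → ℕ → Carrier
    wordSum {m} w y = ∑ (λ x → (x ^ q-1) ^ (4 +ℕ 2 ^ℕ m *ℕ y) * product (pencil (x ^ q-1)) w)

    pencil-^ : ∀ m l v → pencil v l ^ (2 ^ℕ m) ≈ combine m l (λ i → (v ^ i) ^ (2 ^ℕ m))
    pencil-^ m l@(α , β) v = begin
      pencil v l ^ Q
        ≈⟨ ^-congˡ Q (solve 6 (λ a b c α β v →
             α :* (con true :+ a :* v :+ b :* v :^ 3) :+ β :* (v :^ 4 :+ a :* v :^ 3 :+ c :* v) :=
             α :* v :^ 0 :+ (a :* α :+ c :* β) :* v :^ 1 :+ (b :* α :+ a :* β) :* v :^ 3 :+ β :* v :^ 4) refl a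
                 b b̄ α β v) ⟩
      (coeff₀ l * v ^ 0 + coeff₁ l * v ^ 1 + coeff₃ l * v ^ 3 + coeff₄ l * v ^ 4) ^ Q
        ≈⟨ trans (frobenius m _ _) (+-congʳ (trans (frobenius m _ _) (+-congʳ (frobenius m _ _)))) ⟩
      (coeff₀ l * v ^ 0) ^ Q + (coeff₁ l * v ^ 1) ^ Q + (coeff₃ l * v ^ 3) ^ Q + (coeff₄ l * v ^ 4) ^ Q
        ≈⟨ +-cong (+-cong (+-cong (^-distrib-* _ _ Q) (^-distrib-* _ _ Q)) (^-distrib-* _ _ Q)) (^-distrib-* _ _ Q) ⟩
      combine m l (λ i → (v ^ i) ^ Q) ∎
      where
      Q : ℕ
      Q = 2 ^ℕ m

    exponent : ∀ m y i → 4 +ℕ 2 ^ℕ suc m *ℕ y +ℕ i *ℕ 2 ^ℕ m ≡ 4 +ℕ 2 ^ℕ m *ℕ (i +ℕ double y)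
    exponent m y i rewrite double≡2* y =
      +-*-Solver.solve 3 (λ Q y i → con′ 4 :+: con′ 2 :*: Q :*: y :+: i :*: Q :=: con′ 4 :+: Q :*: (i :+: con′
          2 :*: y)) ≡.refl (2 ^ℕ m) y i
      where open +-*-Solver using () renaming (_:*_ to _:*:_; _:+_ to _:+:_; _:=_ to _:=:_; con to con′)

    wordSum-step : ∀ {m} l (w : Vec Letter m) y → wordSum (l ∷ w) y ≈ combine m l (λ i → wordSum w (i +ℕ double y))
    wordSum-step {m} l w y = begin
      ∑ (λ x → (x ^ q-1) ^ (4 +ℕ 2 ^ℕ suc m *ℕ y) * (product (pencil (x ^ q-1)) w * pencil (x ^ q-1) l ^ (2 ^ℕ m)))
        ≈⟨ ∑-cong expand ⟩
      ∑ (λ x → combine m l (g x))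
        ≈⟨ trans (∑-+ _ _) (+-cong (trans (∑-+ _ _) (+-cong (trans (∑-+ _ _) (+-cong (∑-* _ _) (∑-* _ _))) (∑-*
            _ _))) (∑-* _ _)) ⟩
      combine m l (λ i → wordSum w (i +ℕ double y)) ∎
      where
      g : Carrier → ℕ → Carrier
      g x i = (x ^ q-1) ^ (4 +ℕ 2 ^ℕ m *ℕ (i +ℕ double y)) * product (pencil (x ^ q-1)) w
      pull-in : ∀ x i → (x ^ q-1) ^ (4 +ℕ 2 ^ℕ suc m *ℕ y) * (product (pencil (x ^ q-1)) w * ((x ^ q-1) ^ i) ^
          (2 ^ℕ m)) ≈ g x i
      pull-in x i = begin
        V ^ (4 +ℕ 2 ^ℕ suc m *ℕ y) * (P * (V ^ i) ^ (2 ^ℕ m))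
          ≈⟨ solve 3 (λ s p t → s :* (p :* t) := (s :* t) :* p) refl _ P _ ⟩
        V ^ (4 +ℕ 2 ^ℕ suc m *ℕ y) * (V ^ i) ^ (2 ^ℕ m) * P
          ≈⟨ *-congʳ (trans (*-congˡ (^-assocʳ V i (2 ^ℕ m))) (sym (^-homo-* V (4 +ℕ 2 ^ℕ suc m *ℕ y) (i *ℕ 2
              ^ℕ m)))) ⟩
        V ^ (4 +ℕ 2 ^ℕ suc m *ℕ y +ℕ i *ℕ 2 ^ℕ m) * P
          ≈⟨ *-congʳ (^-congʳ V (exponent m y i)) ⟩
        g x i ∎
        where
        V P : Carrier
        V = x ^ q-1
        P = product (pencil V) w
      expand : ∀ x → (x ^ q-1) ^ (4 +ℕ 2 ^ℕ suc m *ℕ y) * (product (pencil (x ^ q-1)) w * pencil (x ^ q-1) l ^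
          (2 ^ℕ m)) ≈ combine m l (g x)
      expand x = begin
        S * (P * pencil (x ^ q-1) l ^ (2 ^ℕ m))
          ≈⟨ *-congˡ (*-congˡ (pencil-^ m l (x ^ q-1))) ⟩
        S * (P * combine m l h)
          ≈⟨ solve 10 (λ s p m₀ m₁ m₃ m₄ h₀ h₁ h₃ h₄ → s :* (p :* (m₀ :* h₀ :+ m₁ :* h₁ :+ m₃ :* h₃ :+ m₄ :* h₄)) :=
               m₀ :* (s :* (p :* h₀)) :+ m₁ :* (s :* (p :* h₁)) :+ m₃ :* (s :* (p :* h₃)) :+ m₄ :* (s :* (p :*
                   h₄))) refl
               S P (coeff₀ l ^ (2 ^ℕ m)) (coeff₁ l ^ (2 ^ℕ m)) (coeff₃ l ^ (2 ^ℕ m)) (coeff₄ l ^ (2 ^ℕ m)) (h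
                   0) (h 1) (h 3) (h 4) ⟩
        combine m l (λ i → S * (P * h i))
          ≈⟨ combine-cong m l (pull-in x) ⟩
        combine m l (g x) ∎
        where
        S P : Carrier
        S = (x ^ q-1) ^ (4 +ℕ 2 ^ℕ suc m *ℕ y)
        P = product (pencil (x ^ q-1)) w
        h : ℕ → Carrier
        h i = ((x ^ q-1) ^ i) ^ (2 ^ℕ m)

    private
      bound-step : ∀ i y j → i ≤ 4 → 4 +ℕ y ≤ doubles 4 j → 4 +ℕ (i +ℕ double y) ≤ doubles 4 (suc j)
      bound-step i y j i≤4 bound = ≤-trans (+-monoʳ-≤ 4 (+-monoˡ-≤ (double y) i≤4)) (double-mono bound)

    -- Since i ≤ 4, the bound on 4 + y doubles with each digit; at the lowest digit it has become
    -- 4q, as `powerSum≈entries` demands.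
    wordSum≈total : ∀ {m} (w : Vec Letter m) j → m +ℕ j ≡ suc k → ∀ y → 4 +ℕ y ≤ doubles 4 j → wordSum w y ≈
        total w j y
    wordSum≈total [] .(suc k) ≡.refl y bound = begin
      wordSum [] y
        ≈⟨ ∑-cong (λ x → trans (*-identityʳ _) (^-congʳ _ (≡.cong (4 +ℕ_) (+ℕ-comm y 0)))) ⟩
      powerSum (4 +ℕ y)
        ≈⟨ powerSum≈entries y (≡.subst (4 +ℕ y ≤_) (doubles≡*2^ 4 (suc k)) bound) ⟩
      entries y
        ≈⟨ +-cong (+-cong (index-cong e₃ 1) (index-cong e₂ 2)) (index-cong e₁ 3) ⟨
      total [] (suc k) y ∎
      where
      index-cong : ∀ u i → entry u (doubles i (suc k)) y ≈ entry u (i *ℕ q) y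
      index-cong u i = reflexive (≡.cong (λ x → entry u x y) (doubles≡*2^ i (suc k)))
    wordSum≈total {suc m} (l ∷ w) j m+j≡k y bound = begin
      wordSum (l ∷ w) y
        ≈⟨ wordSum-step l w y ⟩
      combine m l (λ i → wordSum w (i +ℕ double y))
        ≈⟨ +-cong (+-cong (+-cong (*-congˡ (IH 0 z≤n)) (*-congˡ (IH 1 (s≤s z≤n)))) (*-congˡ (IH 3 (s≤s (s≤s
            (s≤s z≤n)))))) (*-congˡ (IH 4 ≤-refl)) ⟩
      combine m l (λ i → total w (suc j) (i +ℕ double y))
        ≈⟨ total-step l w j y ⟨
      total (l ∷ w) j y ∎
      where
      IH : ∀ i → i ≤ 4 → wordSum w (i +ℕ double y) ≈ total w (suc j) (i +ℕ double y)
      IH i i≤4 = wordSum≈total w (suc j) (≡.trans (+ℕ-suc m j) m+j≡k) (i +ℕ double y) (bound-step i y j i≤4 bound)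

    module _ (ā≈a : a ^ q ≈ a) (f-perm : IsPermutation F (fPoly F q a b)) where
      private
        f : Carrier → Carrier
        f = fPoly F q a b

        f^[q-1] : ∀ x → f x ^ q-1 ≈ (x ^ q-1) ^ 4 * D (x ^ q-1) ^ q-1
        f^[q-1] x = begin
          f x ^ q-1                             ≈⟨ ^-congˡ q-1 (fPoly≈ a b x) ⟩
          (x ^ 4 * D (x ^ q-1)) ^ q-1           ≈⟨ ^-distrib-* _ _ q-1 ⟩
          (x ^ 4) ^ q-1 * D (x ^ q-1) ^ q-1     ≈⟨ *-congʳ (trans (^-assocʳ x 4 q-1) (trans (^-congʳ x (*ℕ-comm
              4 q-1)) (sym (^-assocʳ x q-1 4)))) ⟩
          (x ^ q-1) ^ 4 * D (x ^ q-1) ^ q-1     ∎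

        bar-D : ∀ v → D v ^ q ≈ 1# + a * v ^ q + b̄ * (v ^ q) ^ 3
        bar-D v = trans (bar-+ _ _) (+-cong (trans (bar-+ _ _) (+-cong (1^ q) (trans (bar-* a v) (*-congʳ
            ā≈a)))) (trans (bar-* b _) (*-congˡ (bar-^ v 3))))

        -- The relation f^(q-1) = N/D in multiplied form, which holds also where D vanishes and at x
        -- = 0.
        N≈fD : ∀ x → N (x ^ q-1) ≈ f x ^ q-1 * D (x ^ q-1)
        N≈fD x with x ≟ 0#
        ... | yes x≈0 = trans (N-zero v≈0) (sym (trans (*-congʳ (f^[q-1] x)) (trans (*-congʳ (*-congʳ (trans
            (^-congˡ 4 v≈0) (zeroˡ _)))) (trans (*-congʳ (zeroˡ _)) (zeroˡ _)))))
          where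
          v≈0 : x ^ q-1 ≈ 0#
          v≈0 = trans (^-congˡ q-1 x≈0) (0^ 0<q-1)
          N-zero : ∀ {v} → v ≈ 0# → N v ≈ 0#
          N-zero {v} v≈0 = trans (solve 3 (λ a c v → v :^ 4 :+ a :* v :^ 3 :+ c :* v := (v :^ 3 :+ a :* v :^ 2
              :+ c) :* v) refl a b̄ v) (_ ⊛ v≈0)
        ... | no x≉0 = sym (begin
          f x ^ q-1 * D v                                      ≈⟨ *-congʳ (f^[q-1] x) ⟩
          v ^ 4 * D v ^ q-1 * D v                              ≈⟨ solve 3 (λ s t d → s :* t :* d := s :* (d :*
              t)) refl (v ^ 4) (D v ^ q-1) (D v) ⟩
          v ^ 4 * (D v * D v ^ q-1)                            ≈⟨ *-congˡ (trans (x*x^[q-1]≈x^q (D v)) (bar-D v)) ⟩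
          v ^ 4 * (1# + a * v ^ q + b̄ * (v ^ q) ^ 3)           ≈⟨ solve 4 (λ a c v u → v :^ 4 :* (con true :+
              a :* u :+ c :* u :^ 3) := v :^ 4 :+ a :* v :^ 3 :* (v :* u) :+ c :* v :* (v :* u) :^ 3) refl a b̄
              v (v ^ q) ⟩
          v ^ 4 + a * v ^ 3 * (v * v ^ q) + b̄ * v * (v * v ^ q) ^ 3
                                                               ≈⟨ +-cong (+-congˡ (*-congˡ (norm-one x≉0)))
                                                                   (*-congˡ (^-congˡ 3 (norm-one x≉0))) ⟩
          v ^ 4 + a * v ^ 3 * 1# + b̄ * v * 1# ^ 3              ≈⟨ solve 3 (λ a c v → v :^ 4 :+ a :* v :^ 3 :*
              con true :+ c :* v :* con true :^ 3 := v :^ 4 :+ a :* v :^ 3 :+ c :* v) refl a b̄ v ⟩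
          N v                                                  ∎)
          where
          v : Carrier
          v = x ^ q-1

        pencil≈ : ∀ x l → pencil (x ^ q-1) l ≈ D (x ^ q-1) * linear (f x ^ q-1) l
        pencil≈ x (α , β) = trans (+-congˡ (*-congˡ (N≈fD x)))
          (solve 4 (λ α β d u → α :* d :+ β :* (u :* d) := d :* (α :+ β :* u)) refl α β (D (x ^ q-1)) (f x ^ q-1))

        mersenne≡q-1 : mersenne (suc k) ≡ q-1
        mersenne≡q-1 = suc-injectiveℕ (≡.trans (1+mersenne≡2^ (suc k)) (≡.sym 1+[q-1]≡q))

      -- Hermite's criterion: as f permutes the field,
      -- Σ Φ(f(x)^(q-1)) = Σ Φ(x^(q-1)) for Φ(u) = u ∏ᵢ (αᵢ + βᵢ u)^(2ⁱ).
      wordSum-zero : (w : Vec Letter (suc k)) → wordSum w 0 ≈ 0#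
      wordSum-zero w = begin
        wordSum w 0
          ≈⟨ ∑-cong rewrite-term ⟩
        ∑ (λ x → Φ (f x))
          ≈⟨ ∑-reindex fPoly-cong f-perm Φ Φ-cong ⟨
        ∑ Φ
          ≈⟨ linear-sum w 1 (s≤s z≤n) (≤-reflexive (1+mersenne≡2^ (suc k))) ⟩
        0# ∎
        where
        Φ : Carrier → Carrier
        Φ x = (x ^ q-1) ^ 1 * product (linear (x ^ q-1)) w
        Φ-cong : ∀ {x y} → x ≈ y → Φ x ≈ Φ y
        Φ-cong x≈y = *-cong (^-congˡ 1 (^-congˡ q-1 x≈y)) (product-cong (linear-cong (^-congˡ q-1 x≈y)) w)
        -- One factor D(v)^(2ⁱ) per digit makes D(v)^(q-1), which v⁴ completes to f(x)^(q-1).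
        rewrite-term : ∀ x → (x ^ q-1) ^ (4 +ℕ 2 ^ℕ suc k *ℕ 0) * product (pencil (x ^ q-1)) w ≈ Φ (f x)
        rewrite-term x = begin
          v ^ (4 +ℕ 2 ^ℕ suc k *ℕ 0) * product (pencil v) w
            ≈⟨ *-cong (^-congʳ v (≡.cong (4 +ℕ_) (*ℕ-comm (2 ^ℕ suc k) 0))) (product-scale (D v) (pencil≈ x) w) ⟩
          v ^ 4 * (D v ^ mersenne (suc k) * product (linear (f x ^ q-1)) w)
            ≈⟨ *-congˡ (*-congʳ (^-congʳ (D v) mersenne≡q-1)) ⟩
          v ^ 4 * (D v ^ q-1 * product (linear (f x ^ q-1)) w)
            ≈⟨ *-assoc _ _ _ ⟨
          v ^ 4 * D v ^ q-1 * product (linear (f x ^ q-1)) w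
            ≈⟨ *-congʳ (trans (sym (f^[q-1] x)) (sym (*-identityʳ _))) ⟩
          Φ (f x) ∎
          where
          v : Carrier
          v = x ^ q-1

      -- Target m(q + 1) pairs carry m above the highest digit with carry 4 - m at the lowest, so
      -- the trace is taken against the reversed basis.
      trace-zero : (w : Vec Letter (suc k)) → fst₃ (run w e₃) + snd₃ (run w e₂) + thd₃ (run w e₁) ≈ 0#
      trace-zero w = trans (sym (wordSum≈total w 0 (+ℕ-comm (suc k) 0) 0 ≤-refl)) (wordSum-zero w)

-- Necessity of a = b for q at least 4

data Parity : ℕ → Set where
  even : ∀ m → Parity (double m)
  odd  : ∀ m → Parity (suc (double m))

parity : ∀ m → Parity m
parity zero = even 0
parity (suc m) with parity m
... | even j = odd j
... | odd  j = even (suc j)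

module Necessity {c ℓ} (F : Field c ℓ) (k : ℕ) (hasCardinality : HasCardinality F (2 ^ℕ suc k *ℕ 2 ^ℕ suc k))
  {a b : Field.Carrier F} (ā≈a : InSubfield F (2 ^ℕ suc k) a)
  (a≉0 : ¬ Field._≈_ F a (Field.0# F)) (b≉0 : ¬ Field._≈_ F b (Field.0# F))
  (f-perm : IsPermutation F (fPoly F (2 ^ℕ suc k) a b)) where

  open Field F hiding (zero)
  open QuadraticExtension F k hasCardinality
  open PowerSums F k hasCardinality
  open Automaton a b
  open SetoidReasoning setoid
  open Exp semiring using (^-congˡ; ^-congʳ; ^-assocʳ)
  open CommExp commutativeSemiring using (^-distrib-*)

  trace-zero-at : ∀ {m} → m ≡ suc k → (w : Vec Letter m) → fst₃ (run w e₃) + snd₃ (run w e₂) + thd₃ (run w e₁) ≈ 0#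
  trace-zero-at ≡.refl = trace-zero ā≈a f-perm

  record _≋_ (u v : Triple) : Set ℓ where
    constructor ⟪_,_,_⟫
    field
      fst≈ : fst₃ u ≈ fst₃ v
      snd≈ : snd₃ u ≈ snd₃ v
      thd≈ : thd₃ u ≈ thd₃ v
  open _≋_

  ≋-refl : ∀ {u} → u ≋ u
  ≋-refl = ⟪ refl , refl , refl ⟫

  ≋-trans : ∀ {u v w} → u ≋ v → v ≋ w → u ≋ w
  ≋-trans ⟪ p , q , r ⟫ ⟪ p′ , q′ , r′ ⟫ = ⟪ trans p p′ , trans q q′ , trans r r′ ⟫

  transform : Carrier → Carrier → Carrier → Carrier → Triple → Triple
  transform m₀ m₁ m₃ m₄ ⟨ x , y , z ⟩ = ⟨ m₁ * x + m₀ * y , m₃ * x + m₁ * z , m₄ * y + m₃ * z ⟩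

  Triple⟨_⟩ : ℕ → Set
  Triple⟨ m ⟩ = Polynomial m × Polynomial m × Polynomial m

  -- A copy of `transform` in solver syntax, so that the trace of a whole word becomes one
  -- polynomial to normalise.
  transformᴾ : ∀ {m} (m₀ m₁ m₃ m₄ : Polynomial m) → Triple⟨ m ⟩ → Triple⟨ m ⟩
  transformᴾ m₀ m₁ m₃ m₄ (x , y , z) = m₁ :* x :+ m₀ :* y , m₃ :* x :+ m₁ :* z , m₄ :* y :+ m₃ :* z

  traceᴾ : ∀ {m} (u v w : Triple⟨ m ⟩) → Polynomial m
  traceᴾ (x , _ , _) (_ , y , _) (_ , _ , z) = x :+ y :+ z

  step-transform : ∀ m l {m₀ m₁ m₃ m₄ u v} →
    coeff₀ l ^ (2 ^ℕ m) ≈ m₀ → coeff₁ l ^ (2 ^ℕ m) ≈ m₁ → coeff₃ l ^ (2 ^ℕ m) ≈ m₃ → coeff₄ l ^ (2 ^ℕ m) ≈ m₄ →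
    u ≋ v → step m l u ≋ transform m₀ m₁ m₃ m₄ v
  step-transform m l eq₀ eq₁ eq₃ eq₄ ⟪ x , y , z ⟫ =
    ⟪ +-cong (*-cong eq₁ x) (*-cong eq₀ y) , +-cong (*-cong eq₃ x) (*-cong eq₁ z) , +-cong (*-cong eq₄ y)
        (*-cong eq₃ z) ⟫

  private
    0^2^ : ∀ m {x} → x ≈ 0# → x ^ (2 ^ℕ m) ≈ 0#
    0^2^ m x≈0 = trans (^-congˡ (2 ^ℕ m) x≈0) (0^ (m^n>0 2 m))

    1^2^ : ∀ m {x} → x ≈ 1# → x ^ (2 ^ℕ m) ≈ 1#
    1^2^ m x≈1 = trans (^-congˡ (2 ^ℕ m) x≈1) (1^ (2 ^ℕ m))

  K : Carrier
  K = a ^ 2 + b̄ * b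

  -- The degenerate case K = 0

  module Degenerate (K≈0 : K ≈ 0#) (a≉b : ¬ a ≈ b) where
    𝐄 𝐃 : Letter
    𝐄 = a , b
    𝐃 = 1# , 0#

    step-𝐄 : ∀ m {α β u v} → a ^ (2 ^ℕ m) ≈ α → b ^ (2 ^ℕ m) ≈ β → u ≋ v → step m 𝐄 u ≋ transform α 0# 0# β v
    step-𝐄 m α≈ β≈ = step-transform m 𝐄 α≈
      (0^2^ m (trans (solve 3 (λ a b c → a :* a :+ c :* b := a :^ 2 :+ c :* b) refl a b b̄) K≈0))
      (0^2^ m (solve 2 (λ a b → b :* a :+ a :* b := con false) refl a b)) β≈

    step-𝐃 : ∀ m {α β u v} → a ^ (2 ^ℕ m) ≈ α → b ^ (2 ^ℕ m) ≈ β → u ≋ v → step m 𝐃 u ≋ transform 1# α β 0# v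
    step-𝐃 m α≈ β≈ = step-transform m 𝐃 (1^2^ m refl)
      (trans (^-congˡ (2 ^ℕ m) (solve 2 (λ a c → a :* con true :+ c :* con false := a) refl a b̄)) α≈)
      (trans (^-congˡ (2 ^ℕ m) (solve 2 (λ a b → b :* con true :+ a :* con false := b) refl a b)) β≈)
      (0^2^ m refl)

    alternating : ∀ m → Vec Letter (double m)
    alternating zero    = []
    alternating (suc m) = 𝐃 ∷ 𝐄 ∷ alternating m

    module AtLevel (m : ℕ) where
      α β : Carrier
      α = a ^ (2 ^ℕ m)
      β = b ^ (2 ^ℕ m)
      α≉0 : ¬ α ≈ 0#
      α≉0 = ^-nonzero (2 ^ℕ m) a≉0
      β≉0 : ¬ β ≈ 0#
      β≉0 = ^-nonzero (2 ^ℕ m) b≉0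
      α+β≉0 : ¬ α + β ≈ 0#
      α+β≉0 eq = a≉b (x+y≈0⇒x≈y (^-zero⇒zero (2 ^ℕ m) (trans (frobenius m a b) eq)))

      step-𝐃𝐄 : ∀ u → step (suc m) 𝐃 (step m 𝐄 u) ≋ transform 1# (α ^ 2) (β ^ 2) 0# (transform α 0# 0# β u)
      step-𝐃𝐄 u = step-𝐃 (suc m) (^2^suc m a) (^2^suc m b) (step-𝐄 m refl refl ≋-refl)

      -- 𝐄 retains only the middle coordinate, so each block 𝐃𝐄 multiplies that coordinate by αβ(α +
      -- β), which is nonzero for a ≠ b.
      𝐃𝐄 : ∀ u → step (suc m) 𝐃 (step m 𝐄 u) ≋
        ⟨ (α ^ 3) * snd₃ u , (α * β * (α + β)) * snd₃ u , (β ^ 3) * snd₃ u ⟩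
      𝐃𝐄 u = ≋-trans (step-𝐃𝐄 u)
        ⟪ solve 5 (λ α β x y z → proj₁ (expr α β x y z) := α :^ 3 :* y) refl α β (fst₃ u) (snd₃ u) (thd₃ u)
        , solve 5 (λ α β x y z → proj₁ (proj₂ (expr α β x y z)) := α :* β :* (α :+ β) :* y) refl α β (fst₃ u)
            (snd₃ u) (thd₃ u)
        , solve 5 (λ α β x y z → proj₂ (proj₂ (expr α β x y z)) := β :^ 3 :* y) refl α β (fst₃ u) (snd₃ u) (thd₃ u) ⟫
        where
        expr : ∀ {m} (α β x y z : Polynomial m) → Triple⟨ m ⟩
        expr α β x y z = transformᴾ (con true) (α :^ 2) (β :^ 2) (con false) (transformᴾ α (con false) (con
            false) β (x , y , z))

      𝐃𝐃𝐄 : ∀ u → step (suc (suc m)) 𝐃 (step (suc m) 𝐃 (step m 𝐄 u)) ≋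
        transform 1# ((α ^ 2) ^ 2) ((β ^ 2) ^ 2) 0# ⟨ (α ^ 3) * snd₃ u , (α * β * (α + β)) * snd₃ u , (β ^ 3) *
            snd₃ u ⟩
      𝐃𝐃𝐄 u = step-𝐃 (suc (suc m)) (trans (^2^suc (suc m) a) (^-congˡ 2 (^2^suc m a))) (trans (^2^suc (suc m)
          b) (^-congˡ 2 (^2^suc m b))) (𝐃𝐄 u)

    run₁ : ∀ m → snd₃ (run (alternating m) e₁) ≈ 0#
    run₁ zero    = refl
    run₁ (suc m) = trans (snd≈ (AtLevel.𝐃𝐄 (double m) _)) (_ ⊛ run₁ m)

    run₃ : ∀ m → snd₃ (run (alternating m) e₃) ≈ 0#
    run₃ zero    = refl
    run₃ (suc m) = trans (snd≈ (AtLevel.𝐃𝐄 (double m) _)) (_ ⊛ run₃ m)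

    run₂ : ∀ m → ¬ snd₃ (run (alternating m) e₂) ≈ 0#
    run₂ zero    = 1≉0
    run₂ (suc m) eq = *-nonzero (*-nonzero (*-nonzero α≉0 β≉0) α+β≉0) (run₂ m) (trans (sym (snd≈ (𝐃𝐄 _))) eq)
      where open AtLevel (double m)

    even-contradiction : ∀ m → ¬ suc (suc (double m)) ≡ suc k
    even-contradiction m eq = run₂ (suc m) (begin
      snd₃ (run w e₂)                                              ≈⟨ trans (+-identityʳ _) (+-identityˡ _) ⟨
      0# + snd₃ (run w e₂) + 0#                                    ≈⟨ +-cong (+-congʳ (trans (fst≈ (𝐃𝐄 _)) (_ ⊛
          run₃ m))) (trans (thd≈ (𝐃𝐄 _)) (_ ⊛ run₁ m)) ⟨
      fst₃ (run w e₃) + snd₃ (run w e₂) + thd₃ (run w e₁)          ≈⟨ trace-zero-at eq w ⟩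
      0#                                                           ∎)
      where
      open AtLevel (double m)
      w : Vec Letter (double (suc m))
      w = alternating (suc m)

    -- One more 𝐃 above the blocks adjusts the parity; the middle coordinate becomes α³β³(α + β) y.
    odd-contradiction : ∀ m → ¬ suc (suc (suc (double m))) ≡ suc k
    odd-contradiction m eq = *-nonzero (*-nonzero (*-nonzero (^-nonzero 3 α≉0) (^-nonzero 3 β≉0)) α+β≉0) (run₂
        m) (begin
      α ^ 3 * β ^ 3 * (α + β) * y₂
        ≈⟨ solve 3 (λ α β y → α :^ 3 :* β :^ 3 :* (α :+ β) :* y := traceᴾ (expr α β (con false)) (expr α β y)
            (expr α β (con false))) refl α β y₂ ⟩
      fst₃ (expr′ 0#) + snd₃ (expr′ y₂) + thd₃ (expr′ 0#)
        ≈⟨ +-cong (+-congʳ (fst≈ (expr′-cong (run₃ m)))) (thd≈ (expr′-cong (run₁ m))) ⟨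
      fst₃ (expr′ (snd₃ (run (alternating m) e₃))) + snd₃ (expr′ y₂) + thd₃ (expr′ (snd₃ (run (alternating m) e₁)))
        ≈⟨ +-cong (+-cong (fst≈ (𝐃𝐃𝐄 _)) (snd≈ (𝐃𝐃𝐄 _))) (thd≈ (𝐃𝐃𝐄 _)) ⟨
      fst₃ (run w e₃) + snd₃ (run w e₂) + thd₃ (run w e₁)
        ≈⟨ trace-zero-at eq w ⟩
      0# ∎)
      where
      open AtLevel (double m)
      w : Vec Letter (suc (double (suc m)))
      w = 𝐃 ∷ alternating (suc m)
      y₂ : Carrier
      y₂ = snd₃ (run (alternating m) e₂)
      expr : ∀ {m} (α β y : Polynomial m) → Triple⟨ m ⟩
      expr α β y = transformᴾ (con true) ((α :^ 2) :^ 2) ((β :^ 2) :^ 2) (con false) (α :^ 3 :* y , α :* β :*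
          (α :+ β) :* y , β :^ 3 :* y)
      expr′ : Carrier → Triple
      expr′ y = transform 1# ((α ^ 2) ^ 2) ((β ^ 2) ^ 2) 0# ⟨ α ^ 3 * y , α * β * (α + β) * y , β ^ 3 * y ⟩
      expr′-cong : ∀ {x y} → x ≈ y → expr′ x ≋ expr′ y
      expr′-cong x≈y = ⟪ +-cong (*-congˡ (*-congˡ x≈y)) (*-congˡ (*-congˡ x≈y)) , +-cong (*-congˡ (*-congˡ
          x≈y)) (*-congˡ (*-congˡ x≈y)) , +-cong (*-congˡ (*-congˡ x≈y)) (*-congˡ (*-congˡ x≈y)) ⟫

  -- The nondegenerate case

  module Nondegenerate (K≉0 : ¬ K ≈ 0#) where
    κ P R S : Carrier
    κ = (K ⁻¹) K≉0
    P = a * κ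
    R = b̄ * κ
    S = b * κ

    Kκ≈1 : K * κ ≈ 1#
    Kκ≈1 = ⁻¹-inverse K K≉0

    κ≉0 : ¬ κ ≈ 0#
    κ≉0 = ⁻¹-nonzero K K≉0

    P≉0 : ¬ P ≈ 0#
    P≉0 = *-nonzero a≉0 κ≉0

    R≉0 : ¬ R ≈ 0#
    R≉0 = *-nonzero (^-nonzero q b≉0) κ≉0

    S≉0 : ¬ S ≈ 0#
    S≉0 = *-nonzero b≉0 κ≉0

    bar-κ : κ ^ q ≈ κ
    bar-κ = bar-⁻¹ K≉0 (begin
      K ^ q                          ≈⟨ bar-+ _ _ ⟩
      (a ^ 2) ^ q + (b̄ * b) ^ q      ≈⟨ +-cong (trans (bar-^ a 2) (^-congˡ 2 ā≈a)) (trans (bar-* b̄ b)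
          (*-congʳ (bar-involutive b))) ⟩
      a ^ 2 + b * b̄                  ≈⟨ +-congˡ (*-comm b b̄) ⟩
      K                              ∎)

    bar-P : P ^ q ≈ P
    bar-P = trans (bar-* a κ) (*-cong ā≈a bar-κ)

    bar-R : R ^ q ≈ S
    bar-R = trans (bar-* b̄ κ) (*-cong (bar-involutive b) bar-κ)

    bar-S : S ^ q ≈ R
    bar-S = trans (bar-* b κ) (*-congˡ bar-κ)

    P²+RS≈κ : P ^ 2 + R * S ≈ κ
    P²+RS≈κ = begin
      P ^ 2 + R * S  ≈⟨ solve 4 (λ a b c κ → (a :* κ) :^ 2 :+ (c :* κ) :* (b :* κ) := (a :^ 2 :+ c :* b) :* κ
          :* κ) refl a b b̄ κ ⟩
      K * κ * κ      ≈⟨ *-congʳ Kκ≈1 ⟩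
      1# * κ         ≈⟨ *-identityˡ κ ⟩
      κ              ∎

    data Sort : Set where
      A B : Sort

    letter : Sort → Letter
    letter A = P , S
    letter B = R , P

    move : Sort → (p r s : Carrier) → Triple → Triple
    move A p r s = transform p 1# 0# s
    move B p r s = transform r 0# 1# p

    moveᴾ : ∀ {m} → Sort → (p r s : Polynomial m) → Triple⟨ m ⟩ → Triple⟨ m ⟩
    moveᴾ A p r s = transformᴾ p (con true) (con false) s
    moveᴾ B p r s = transformᴾ r (con false) (con true) p

    step-move : ∀ m l {p r s u v} → P ^ (2 ^ℕ m) ≈ p → R ^ (2 ^ℕ m) ≈ r → S ^ (2 ^ℕ m) ≈ s →
                u ≋ v → step m (letter l) u ≋ move l p r s v
    step-move m A p≈ r≈ s≈ = step-transform m (letter A) p≈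
      (1^2^ m (trans (solve 4 (λ a b c κ → a :* (a :* κ) :+ c :* (b :* κ) := (a :^ 2 :+ c :* b) :* κ) refl a b
          b̄ κ) Kκ≈1))
      (0^2^ m (solve 3 (λ a b κ → b :* (a :* κ) :+ a :* (b :* κ) := con false) refl a b κ)) s≈
    step-move m B p≈ r≈ s≈ = step-transform m (letter B) r≈
      (0^2^ m (solve 3 (λ a c κ → a :* (c :* κ) :+ c :* (a :* κ) := con false) refl a b̄ κ))
      (1^2^ m (trans (solve 4 (λ a b c κ → b :* (c :* κ) :+ a :* (a :* κ) := (a :^ 2 :+ c :* b) :* κ) refl a b
          b̄ κ) Kκ≈1)) p≈

    letters : ∀ {m} → Vec Sort m → Vec Letter m
    letters []      = []
    letters (l ∷ w) = letter l ∷ letters w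

    -- The word A²ᵐ takes e₂ to (t, σ, 0) and e₃ to (t², 0, σ²).
    tσ : ℕ → Carrier × Carrier
    tσ zero    = 0# , 1#
    tσ (suc m) = proj₁ (tσ m) + P ^ (2 ^ℕ double m) * proj₂ (tσ m) , S ^ (2 ^ℕ double m) * proj₂ (tσ m)

    Aⁿ : ∀ m → Vec Sort m
    Aⁿ m = replicate m A

    record Runs {m} (w : Vec Sort m) (u₁ u₂ u₃ : Triple) : Set ℓ where
      constructor runs
      field
        run₁ : run (letters w) e₁ ≋ u₁
        run₂ : run (letters w) e₂ ≋ u₂
        run₃ : run (letters w) e₃ ≋ u₃

    runs-step : ∀ {m} {w : Vec Sort m} l {p r s u₁ u₂ u₃} → P ^ (2 ^ℕ m) ≈ p → R ^ (2 ^ℕ m) ≈ r → S ^ (2 ^ℕ m) ≈ s →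
                Runs w u₁ u₂ u₃ → Runs (l ∷ w) (move l p r s u₁) (move l p r s u₂) (move l p r s u₃)
    runs-step {m} l p≈ r≈ s≈ (runs ρ₁ ρ₂ ρ₃) =
      runs (step-move m l p≈ r≈ s≈ ρ₁) (step-move m l p≈ r≈ s≈ ρ₂) (step-move m l p≈ r≈ s≈ ρ₃)

    runs-≋ : ∀ {m} {w : Vec Sort m} {u₁ u₂ u₃ v₁ v₂ v₃} → Runs w u₁ u₂ u₃ → u₁ ≋ v₁ → u₂ ≋ v₂ → u₃ ≋ v₃ → Runs
        w v₁ v₂ v₃
    runs-≋ (runs ρ₁ ρ₂ ρ₃) e f g = runs (≋-trans ρ₁ e) (≋-trans ρ₂ f) (≋-trans ρ₃ g)

    trace-of-runs : ∀ {m} {w : Vec Sort m} {u₁ u₂ u₃} → m ≡ suc k → Runs w u₁ u₂ u₃ → fst₃ u₃ + snd₃ u₂ + thd₃ u₁ ≈ 0#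
    trace-of-runs {w = w} eq (runs ρ₁ ρ₂ ρ₃) =
      trans (sym (+-cong (+-cong (fst≈ ρ₃) (snd≈ ρ₂)) (thd≈ ρ₁))) (trace-zero-at eq (letters w))

    -- A takes e₃ to e₂, so the run on e₃ is a run on e₂ moved up by one digit; this is why squares
    -- of t and σ appear.
    runs-A²ᵐ : ∀ m → let (t , σ) = tσ m in
      Runs (Aⁿ (double m)) ⟨ 1# , 0# , 0# ⟩ ⟨ t , σ , 0# ⟩ ⟨ t ^ 2 , 0# , σ ^ 2 ⟩
    runs-A²ᵐ zero = runs ≋-refl ≋-refl
      ⟪ solve 0 (con false := con false :^ 2) refl , refl , solve 0 (con true := con true :^ 2) refl ⟫
    runs-A²ᵐ (suc m) = runs-≋
      (runs-step A (^2^suc n′ P) (^2^suc n′ R) (^2^suc n′ S) (runs-step A refl refl refl (runs-A²ᵐ m)))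
      ⟪ solve 2 (λ p s → proj₁ (AA p s (con true , con false , con false)) := con true) refl p s
      , solve 2 (λ p s → proj₁ (proj₂ (AA p s (con true , con false , con false))) := con false) refl p s
      , solve 2 (λ p s → proj₂ (proj₂ (AA p s (con true , con false , con false))) := con false) refl p s ⟫
      ⟪ solve 4 (λ p s t σ → proj₁ (AA p s (t , σ , con false)) := t :+ p :* σ) refl p s t σ
      , solve 4 (λ p s t σ → proj₁ (proj₂ (AA p s (t , σ , con false))) := s :* σ) refl p s t σ
      , solve 4 (λ p s t σ → proj₂ (proj₂ (AA p s (t , σ , con false))) := con false) refl p s t σ ⟫
      ⟪ solve 4 (λ p s t σ → proj₁ (AA p s (t :^ 2 , con false , σ :^ 2)) := (t :+ p :* σ) :^ 2) refl p s t σ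
      , solve 4 (λ p s t σ → proj₁ (proj₂ (AA p s (t :^ 2 , con false , σ :^ 2))) := con false) refl p s t σ
      , solve 4 (λ p s t σ → proj₂ (proj₂ (AA p s (t :^ 2 , con false , σ :^ 2))) := (s :* σ) :^ 2) refl p s t σ ⟫
      where
      n′ : ℕ
      n′ = double m
      p s t σ : Carrier
      p = P ^ (2 ^ℕ n′)
      s = S ^ (2 ^ℕ n′)
      t = proj₁ (tσ m)
      σ = proj₂ (tσ m)
      AA : ∀ {m} (p s : Polynomial m) → Triple⟨ m ⟩ → Triple⟨ m ⟩
      AA p s u = transformᴾ (p :^ 2) (con true) (con false) (s :^ 2) (transformᴾ p (con true) (con false) s u)

    σ≉0 : ∀ m → ¬ proj₂ (tσ m) ≈ 0#
    σ≉0 zero    = 1≉0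
    σ≉0 (suc m) = *-nonzero (^-nonzero (2 ^ℕ double m) S≉0) (σ≉0 m)

    module Tail (m : ℕ) where
      private
        n′ : ℕ
        n′ = double m

      p r s t σ : Carrier
      p = P ^ (2 ^ℕ n′)
      r = R ^ (2 ^ℕ n′)
      s = S ^ (2 ^ℕ n′)
      t = proj₁ (tσ m)
      σ = proj₂ (tσ m)

      p≉0 : ¬ p ≈ 0#
      p≉0 = ^-nonzero (2 ^ℕ n′) P≉0
      r≉0 : ¬ r ≈ 0#
      r≉0 = ^-nonzero (2 ^ℕ n′) R≉0
      s≉0 : ¬ s ≈ 0#
      s≉0 = ^-nonzero (2 ^ℕ n′) S≉0

      sq₂ : ∀ X → X ^ (2 ^ℕ suc (suc n′)) ≈ (X ^ (2 ^ℕ n′)) ^ 4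
      sq₂ X = trans (^2^suc (suc n′) X) (trans (^-congˡ 2 (^2^suc n′ X)) (^-assocʳ _ 2 2))

      sq₃ : ∀ X → X ^ (2 ^ℕ suc (suc (suc n′))) ≈ (X ^ (2 ^ℕ n′)) ^ 8
      sq₃ X = trans (^2^suc (suc (suc n′)) X) (trans (^-congˡ 2 (sq₂ X)) (^-assocʳ _ 4 2))

      Poly₅ : Set
      Poly₅ = Polynomial 5

      traceᴾ₂ : ∀ {m} (l₁ l₀ : Sort) (P R S : Polynomial m) → Polynomial m
      traceᴾ₂ {m} l₁ l₀ P R S = traceᴾ (go (con false :^ 2 , con false , con true :^ 2)) (go (con false , con
          true , con false)) (go (con true , con false , con false))
        where
        go : Triple⟨ m ⟩ → Triple⟨ m ⟩
        go u = moveᴾ l₁ ((P :^ 1) :^ 2) ((R :^ 1) :^ 2) ((S :^ 1) :^ 2) (moveᴾ l₀ (P :^ 1) (R :^ 1) (S :^ 1) u)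

      runs₂ : ∀ l₁ l₀ → Runs (l₁ ∷ l₀ ∷ Aⁿ n′) _ _ _
      runs₂ l₁ l₀ = runs-step l₁ (^2^suc n′ P) (^2^suc n′ R) (^2^suc n′ S) (runs-step l₀ refl refl refl (runs-A²ᵐ m))

      runs₃ : ∀ l₂ l₁ l₀ → Runs (l₂ ∷ l₁ ∷ l₀ ∷ Aⁿ n′) _ _ _
      runs₃ l₂ l₁ l₀ = runs-step l₂ (sq₂ P) (sq₂ R) (sq₂ S) (runs₂ l₁ l₀)

      runs₄ : ∀ l₃ l₂ l₁ l₀ → Runs (l₃ ∷ l₂ ∷ l₁ ∷ l₀ ∷ Aⁿ n′) _ _ _
      runs₄ l₃ l₂ l₁ l₀ = runs-step l₃ (sq₃ P) (sq₃ R) (sq₃ S) (runs₃ l₂ l₁ l₀)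

      traceᴾ₃ : (l₂ l₁ l₀ : Sort) (p r s t σ : Poly₅) → Poly₅
      traceᴾ₃ l₂ l₁ l₀ p r s t σ = traceᴾ (go (t :^ 2 , con false , σ :^ 2)) (go (t , σ , con false)) (go (con
          true , con false , con false))
        where
        go : Triple⟨ 5 ⟩ → Triple⟨ 5 ⟩
        go u = moveᴾ l₂ (p :^ 4) (r :^ 4) (s :^ 4) (moveᴾ l₁ (p :^ 2) (r :^ 2) (s :^ 2) (moveᴾ l₀ p r s u))

      traceᴾ₄ : (l₃ l₂ l₁ l₀ : Sort) (p r s t σ : Poly₅) → Poly₅
      traceᴾ₄ l₃ l₂ l₁ l₀ p r s t σ = traceᴾ (go (t :^ 2 , con false , σ :^ 2)) (go (t , σ , con false)) (go
          (con true , con false , con false))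
        where
        go : Triple⟨ 5 ⟩ → Triple⟨ 5 ⟩
        go u = moveᴾ l₃ (p :^ 8) (r :^ 8) (s :^ 8) (moveᴾ l₂ (p :^ 4) (r :^ 4) (s :^ 4) (moveᴾ l₁ (p :^ 2) (r
            :^ 2) (s :^ 2) (moveᴾ l₀ p r s u)))

      -- The word of A alone has trace t² + p²σ². Changing one letter to B gives s²t plus a multiple
      -- of that trace, so t = 0 and then pσ = 0.
      odd-contradiction : ¬ suc (suc (suc n′)) ≡ suc k
      odd-contradiction eq = *-nonzero (^-nonzero 2 p≉0) (^-nonzero 2 (σ≉0 m))
        (trans (solve 3 (λ p t σ → p :^ 2 :* σ :^ 2 := (t :^ 2 :+ p :^ 2 :* σ :^ 2) :+ t :* t) refl p t σ)
          (AAA ⊹ t ⊛ t≈0))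
        where
        AAA : t ^ 2 + p ^ 2 * σ ^ 2 ≈ 0#
        AAA = trans (solve 5 (λ p r s t σ → t :^ 2 :+ p :^ 2 :* σ :^ 2 := traceᴾ₃ A A A p r s t σ) refl p r s t σ)
          (trace-of-runs eq (runs₃ A A A))
        AAB : s ^ 2 * t + p ^ 2 * (t ^ 2 + p ^ 2 * σ ^ 2) ≈ 0#
        AAB = trans (solve 5 (λ p r s t σ → s :^ 2 :* t :+ p :^ 2 :* (t :^ 2 :+ p :^ 2 :* σ :^ 2) := traceᴾ₃ A
            A B p r s t σ) refl p r s t σ)
          (trace-of-runs eq (runs₃ A A B))
        t≈0 : t ≈ 0#
        t≈0 = cancel-factor (^-nonzero 2 s≉0) (trans
          (solve 4 (λ p s t σ → s :^ 2 :* t := (s :^ 2 :* t :+ p :^ 2 :* (t :^ 2 :+ p :^ 2 :* σ :^ 2)) :+ p :^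
              2 :* (t :^ 2 :+ p :^ 2 :* σ :^ 2)) refl p s t σ)
          (AAB ⊹ p ^ 2 ⊛ AAA))

      even-contradiction : ¬ suc (suc (suc (suc n′))) ≡ suc k
      even-contradiction eq = contradiction p₁²+r₁s₁≉0 conjugate-cubic
        -- This relation is no trace: it holds identically for S = sσ and Q = σ².
        (solve 2 (λ s σ → (s :* σ) :^ 2 :+ s :^ 2 :* σ :^ 2 := con false) refl s σ)
        (trans (solve 5 (λ p r s t σ → (t :+ p :* σ) :+ (p :^ 2) :^ 2 :* (s :* σ) :+ (r :^ 2) :^ 4 :* (s :* σ)
            :^ 2 := traceᴾ₄ B A A A p r s t σ) refl p r s t σ)
          (trace-of-runs eq (runs₄ B A A A)))
        (trans (solve 5 (λ p r s t σ → (s :^ 2) :^ 2 :+ (p :^ 2) :^ 2 :* (t :+ p :* σ) :+ (r :^ 2) :^ 4 :* p :^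
            2 :* σ :^ 2 := traceᴾ₄ B A B A p r s t σ) refl p r s t σ)
          (trace-of-runs eq (runs₄ B A B A)))
        where
        -- All five words have A at digit `n′`. After it e₂ has become (T, 0, S) and e₃ has become
        -- (t², Q, 0) with t² = T² + p²Q; the last three letters start from the squares of p, r, s.
        open EvenCase {p = p ^ 2} {r = r ^ 2} {s = s ^ 2} {T = t + p * σ} {S = s * σ} {Q = σ ^ 2}
          (^-nonzero 2 p≉0) (^-nonzero 2 r≉0) (^-nonzero 2 (σ≉0 m))
          (trans (solve 5 (λ p r s t σ → (p :^ 2) :^ 4 :+ (r :^ 2) :^ 2 :* (s :* σ) :+ (r :^ 2) :^ 4 :* (t :+ p
              :* σ) :^ 2 := traceᴾ₄ B B A A p r s t σ) refl p r s t σ)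
            (trace-of-runs eq (runs₄ B B A A)))
          (trans (solve 5 (λ p r s t σ → (p :^ 2) :^ 2 :* (t :+ p :* σ) :+ s :* σ :+ (r :^ 2) :^ 2 :* ((t :+ p
              :* σ) :^ 2 :+ p :^ 2 :* σ :^ 2) :+ (p :^ 2) :^ 4 :* r :^ 2 :* σ :^ 2 := traceᴾ₄ A B B A p r s t
              σ) refl p r s t σ)
            (trace-of-runs eq (runs₄ A B B A)))
          (trans (solve 5 (λ p r s t σ → (p :^ 2) :^ 2 :+ (r :^ 2) :^ 2 :* (t :+ p :* σ) :+ (r :^ 2) :^ 5 :* σ
              :^ 2 := traceᴾ₄ B B B A p r s t σ) refl p r s t σ)
            (trace-of-runs eq (runs₄ B B B A)))
        bar-level : ∀ {X Y} → X ^ q ≈ Y → ((X ^ (2 ^ℕ n′)) ^ 2) ^ q ≈ (Y ^ (2 ^ℕ n′)) ^ 2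
        bar-level {X} X̄≈Y = trans (bar-^ _ 2) (^-congˡ 2 (trans (bar-^ X (2 ^ℕ n′)) (^-congˡ (2 ^ℕ n′) X̄≈Y)))
        -- Conjugation fixes P and takes R to S, and it commutes with the powers 2ⁱ.
        conjugate-cubic : p ^ 2 * (s ^ 2) ^ 2 + s ^ 2 + (p ^ 2) ^ 3 ≈ 0#
        conjugate-cubic = begin
          p ^ 2 * (s ^ 2) ^ 2 + s ^ 2 + (p ^ 2) ^ 3
            ≈⟨ +-cong (+-cong (trans (bar-* _ _) (*-cong (bar-level bar-P) (trans (bar-^ _ 2) (^-congˡ 2
                (bar-level bar-R))))) (bar-level bar-R)) (trans (bar-^ _ 3) (^-congˡ 3 (bar-level bar-P))) ⟨
          (p ^ 2 * (r ^ 2) ^ 2) ^ q + (r ^ 2) ^ q + ((p ^ 2) ^ 3) ^ q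
            ≈⟨ trans (bar-+ _ _) (+-congʳ (bar-+ _ _)) ⟨
          (p ^ 2 * (r ^ 2) ^ 2 + r ^ 2 + (p ^ 2) ^ 3) ^ q
            ≈⟨ trans (^-congˡ q cubic) (0^ 0<q) ⟩
          0# ∎
        p₁²+r₁s₁≉0 : ¬ (p ^ 2) ^ 2 + r ^ 2 * s ^ 2 ≈ 0#
        p₁²+r₁s₁≉0 eq₀ = κ≉0 (^-zero⇒zero (2 ^ℕ n′) (^-zero⇒zero 2 (begin
          (κ ^ (2 ^ℕ n′)) ^ 2                        ≈⟨ ^-congˡ 2 (^-congˡ (2 ^ℕ n′) P²+RS≈κ) ⟨
          ((P ^ 2 + R * S) ^ (2 ^ℕ n′)) ^ 2          ≈⟨ ^-congˡ 2 (trans (frobenius n′ _ _) (+-cong (trans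
              (^-assocʳ P 2 (2 ^ℕ n′)) (trans (^-congʳ P (*ℕ-comm 2 (2 ^ℕ n′))) (sym (^-assocʳ P (2 ^ℕ n′)
              2)))) (^-distrib-* R S (2 ^ℕ n′)))) ⟩
          (p ^ 2 + r * s) ^ 2                        ≈⟨ solve 3 (λ p r s → (p :^ 2 :+ r :* s) :^ 2 := (p :^ 2)
              :^ 2 :+ r :^ 2 :* s :^ 2) refl p r s ⟩
          (p ^ 2) ^ 2 + r ^ 2 * s ^ 2                ≈⟨ eq₀ ⟩
          0#                                         ∎)))

    -- For q = 4 the power sums vanish also for a = ω, b = ω²; then 1 is a root of f.
    two-contradiction : ¬ 2 ≡ suc k
    two-contradiction eq = 1≉0 (proj₁ f-perm 1# 0# (trans f1≈0 (sym f0≈0)))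
      where
      open Tail 0
      S+P²≈0 : S + P ^ 2 ≈ 0#
      S+P²≈0 = trans (solve 3 (λ P R S → S :+ P :^ 2 := traceᴾ₂ A A P R S) refl P R S) (trace-of-runs eq (runs₂ A A))
      P+R²≈0 : P + R ^ 2 ≈ 0#
      P+R²≈0 = trans (solve 3 (λ P R S → P :+ R :^ 2 := traceᴾ₂ B A P R S) refl P R S) (trace-of-runs eq (runs₂ B A))
      R+P²≈0 : R + P ^ 2 ≈ 0#
      R+P²≈0 = begin
        R + P ^ 2             ≈⟨ +-cong bar-S (trans (bar-^ P 2) (^-congˡ 2 bar-P)) ⟨
        S ^ q + (P ^ 2) ^ q   ≈⟨ bar-+ S _ ⟨
        (S + P ^ 2) ^ q       ≈⟨ trans (^-congˡ q S+P²≈0) (0^ 0<q) ⟩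
        0#                    ∎
      K*κ* : ∀ x → K * (x * κ) ≈ x
      K*κ* x = trans (solve 3 (λ K x κ → K :* (x :* κ) := K :* κ :* x) refl K x κ) (trans (*-congʳ Kκ≈1)
          (*-identityˡ x))
      f1≈0 : fPoly F q a b 1# ≈ 0#
      f1≈0 = begin
        fPoly F q a b 1#                          ≈⟨ trans (fPoly≈form a b 1#) (form-cong refl (1^ q)) ⟩
        form a b 1# 1#                            ≈⟨ solve 2 (λ a b → con true :^ 4 :+ a :* con true :^ 3 :*
            con true :+ b :* con true :* con true :^ 3 := con true :+ a :+ b) refl a b ⟩
        1# + a + b                                ≈⟨ +-cong (+-cong (trans (*-congˡ P²+RS≈κ) Kκ≈1) (K*κ* a))
            (K*κ* b) ⟨
        K * (P ^ 2 + R * S) + K * P + K * S       ≈⟨ solve 4 (λ K P R S → K :* (P :^ 2 :+ R :* S) :+ K :* P :+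
            K :* S :=
                                                       K :* ((P :^ 2 :+ con true) :* (S :+ P :^ 2) :+ ((S :+ R
                                                           :+ P :^ 2) :* (R :+ P :^ 2) :+ (P :+ R :^ 2)))) refl
                                                           K P R S ⟩
        K * ((P ^ 2 + 1#) * (S + P ^ 2) + ((S + R + P ^ 2) * (R + P ^ 2) + (P + R ^ 2)))
                                                  ≈⟨ K ⊛ ((P ^ 2 + 1#) ⊛ S+P²≈0 ⊹ (S + R + P ^ 2) ⊛ R+P²≈0 ⊹ P+R²≈0) ⟩
        0#                                        ∎
      f0≈0 : fPoly F q a b 0# ≈ 0#
      f0≈0 = trans (*-congʳ (zeroˡ _)) (zeroˡ _)

  private
    three-or-more : ∀ m → suc (suc (suc m)) ≡ suc k → a ≈ b
    three-or-more m eq with a ≟ b | K ≟ 0# | parity m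
    ... | yes a≈b | _       | _      = a≈b
    ... | no a≉b  | yes K≈0 | even j = ⊥-elim (Degenerate.odd-contradiction K≈0 a≉b j eq)
    ... | no a≉b  | yes K≈0 | odd  j = ⊥-elim (Degenerate.even-contradiction K≈0 a≉b (suc j) eq)
    ... | no a≉b  | no K≉0  | even j = ⊥-elim (Nondegenerate.Tail.odd-contradiction K≉0 j eq)
    ... | no a≉b  | no K≉0  | odd  j = ⊥-elim (Nondegenerate.Tail.even-contradiction K≉0 j eq)

    -- The nondegenerate arguments spend at least three letters after a run of A, so length 2 stands
    -- apart.
    two : 2 ≡ suc k → a ≈ b
    two eq with a ≟ b | K ≟ 0#
    ... | yes a≈b | _       = a≈b
    ... | no a≉b  | yes K≈0 = ⊥-elim (Degenerate.even-contradiction K≈0 a≉b 0 eq)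
    ... | no a≉b  | no K≉0  = ⊥-elim (Nondegenerate.two-contradiction K≉0 eq)

  a≈b-if-1<k : ∀ m → suc (suc m) ≡ suc k → a ≈ b
  a≈b-if-1<k zero    = two
  a≈b-if-1<k (suc m) = three-or-more m

-- The case q = 2 and the conclusion

-- For q = 2 the sums carry no information; instead f(1 + b) = 0.
a≈b-if-q≡2 : ∀ {c ℓ} (F : Field c ℓ) → let open Field F in HasCardinality F 4 → ∀ {a b} →
             a ^ 2 ≈ a → ¬ a ≈ 0# → IsPermutation F (fPoly F 2 a b) → a ≈ b
a≈b-if-q≡2 F hc {a} {b} a²≈a a≉0 f-perm = trans a≈1 (x+y≈0⇒x≈y 1+b≈0)
  where
  open Field F hiding (zero)
  open QuadraticExtension F 0 hc
  open SetoidReasoning setoid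
  a≈1 : a ≈ 1#
  a≈1 = *-cancelˡ a a≉0 (trans (solve 1 (λ a → a :* a := a :^ 2) refl a) (trans a²≈a (sym (*-identityʳ a))))
  f0≈0 : fPoly F 2 a b 0# ≈ 0#
  f0≈0 = trans (*-congʳ (zeroˡ _)) (zeroˡ _)
  1+b≈0 : 1# + b ≈ 0#
  1+b≈0 = decidable-stable ((1# + b) ≟ 0#) λ x≉0 → x≉0 (proj₁ f-perm _ _ (trans (begin
    fPoly F 2 a b (1# + b)
      ≈⟨ fPoly≈form a b (1# + b) ⟩
    form a b (1# + b) ((1# + b) ^ 2)
      ≈⟨ solve 2 (λ a b → let x = con true :+ b in x :^ 4 :+ a :* x :^ 3 :* x :^ 2 :+ b :* x :* (x :^ 2) :^ 3 :=
           (x :^ 5) :* (a :+ con true) :+ (x :^ 4 :* b) :* (x :^ 3 :+ con true)) refl a b ⟩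
    ((1# + b) ^ 5) * (a + 1#) + ((1# + b) ^ 4 * b) * ((1# + b) ^ 3 + 1#)
      -- Nonzero elements of the field with four elements satisfy x³ = 1; here x = 1 + b.
      ≈⟨ _ ⊛ x≈y⇒x+y≈0 a≈1 ⊹ _ ⊛ x≈y⇒x+y≈0 (x^n≈1 x≉0) ⟩
    0# ∎) (sym f0≈0)))

theorem1p1 : ∀ {c ℓ} (F : Field c ℓ) (k : ℕ) →
  let open Field F
      q = 2 ^ℕ k
  in HasCardinality F (q *ℕ q) →
     (a b : Carrier) → InSubfield F q a → (a≉0 : ¬ (a ≈ 0#)) → ¬ (b ≈ 0#) →
     IsPermutation F (fPoly F q a b)
       ⇔ ((a ≈ b) × ¬ (∃ λ x → InSubfield F q x × (((x ^ 3) + x) + (a ⁻¹) a≉0 ≈ 0#)))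
-- For q = 1 the field would have a single element, against 0 ≠ 1.
theorem1p1 F zero hc a b ā≈a a≉0 b≉0 = ⊥-elim (0≉1 (all-equal (enum-surj 0#) (enum-surj 1#)))
  where
  open Field F hiding (zero)
  open HasCardinality hc
  all-equal : ∀ {x y} → (∃ λ i → enum i ≈ x) → (∃ λ i → enum i ≈ y) → x ≈ y
  all-equal (zero , x≈) (zero , y≈) = trans (sym x≈) y≈
theorem1p1 F (suc k) hc a b ā≈a a≉0 b≉0 = mk⇔ necessary sufficient
  where
  open Field F hiding (zero)
  open QuadraticExtension F k hc
  open EqualCoefficients ā≈a a≉0
  a≈b : ∀ k (hc : HasCardinality F (2 ^ℕ suc k *ℕ 2 ^ℕ suc k)) → InSubfield F (2 ^ℕ suc k) a →
        IsPermutation F (fPoly F (2 ^ℕ suc k) a b) → a ≈ b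
  a≈b zero    hc ā≈a f-perm = a≈b-if-q≡2 F hc ā≈a a≉0 f-perm
  a≈b (suc k) hc ā≈a f-perm = Necessity.a≈b-if-1<k F (suc k) hc ā≈a a≉0 b≉0 f-perm k ≡.refl
  form-b : a ≈ b → ∀ x → fPoly F q a b x ≈ form a a x (x ^ q)
  form-b a≈b x = trans (fPoly≈form a b x) (+-congˡ (*-congʳ (*-congʳ (sym a≈b))))
  necessary : IsPermutation F (fPoly F q a b) → a ≈ b × ¬ HasRoot
  necessary f-perm = eq , λ root → let (x , y , fx≈fy , x≉y) = root⇒collision root in
    x≉y (proj₁ f-perm x y (trans (form-b eq x) (trans fx≈fy (sym (form-b eq y)))))
    where
    eq : a ≈ b
    eq = a≈b k hc ā≈a f-perm
  sufficient : a ≈ b × ¬ HasRoot → IsPermutation F (fPoly F q a b)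
  sufficient (eq , ∄root) = injective⇒permutation fPoly-cong λ x y fx≈fy →
    injective ∄root x y (trans (sym (form-b eq x)) (trans fx≈fy (form-b eq y)))
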